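{- For each integer $r\ge 2$, there exists a constant $C_r>0$ such that for any $0<\varepsilon\le 1/2$, every graph $G$ that contains no complete subgraph on $r+1$ vertices ($K_{r+1}$-free) admits a partition of $V(G)$ into at most $(1/\varepsilon)^{C_r}$ sets, each of which is $\varepsilon$-sparse.
   Context: All graphs are finite and simple. For $\varepsilon>0$ and a graph $G$, a set $S\subseteq V(G)$ is $\varepsilon$-sparse if the induced subgraph $G[S]$ has maximum degree at most $\varepsilon|S|$. Since $K_{r+1}$ is complete, containing it as a subgraph is the same as containing it as an induced subgraph. -}

module Defs where

open import Data.Nat using (ℕ; zero; suc; _+_; _*_; _≤_)
open import Data.Bool using (Bool; true; false; if_then_else_; _∧_)
open import Data.Fin using (Fin; zero; suc; _≟_)
open import Data.Product using (Σ; _×_)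
open import Relation.Binary.PropositionalEquality using (_≡_; _≢_)
open import Relation.Nullary using (¬_)
open import Relation.Nullary.Decidable using (⌊_⌋)

record Graph (n : ℕ) : Set where
  field
    adj    : Fin n → Fin n → Bool
    sym    : ∀ u v → adj u v ≡ adj v u
    irrefl : ∀ v → adj v v ≡ false
open Graph public

count : ∀ {n} → (Fin n → Bool) → ℕ
count {zero}  S = 0
count {suc n} S = (if S zero then 1 else 0) + count (λ i → S (suc i))

degIn : ∀ {n} → Graph n → (Fin n → Bool) → Fin n → ℕ
degIn G S v = count (λ u → S u ∧ adj G v u)

-- S is ε-sparse for ε = p / q: every vertex v of S has
-- deg_{G[S]}(v) ≤ ε |S|, i.e. deg * q ≤ p * |S|.
Sparse : ∀ {n} → ℕ → ℕ → Graph n → (Fin n → Bool) → Set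
Sparse p q G S = ∀ v → S v ≡ true → degIn G S v * q ≤ p * count S

KFree : ∀ {n} → ℕ → Graph n → Set
KFree {n} m G =
  ¬ (Σ (Fin m → Fin n) λ g →
       (∀ i j → g i ≡ g j → i ≡ j) ×
       (∀ i j → i ≢ j → adj G (g i) (g j) ≡ true))

classOf : ∀ {n k} → (Fin n → Fin k) → Fin k → Fin n → Bool
classOf f c v = ⌊ f v ≟ c ⌋

{-# OPTIONS --safe #-}
module Submission where

-- Write ε = 1/m.  A K_{r+1}-free set X contains a sparse subset of size at least |X| / m^{O(r)}, so
-- polynomially many greedy steps leave over only an exponentially small part of X.  To absorb the
-- leftover, build sparse sets V₁, …, V_k (k ≤ r) that are "rich": every vertex with many neighbours
-- in each V_i sees a positive fraction of the K_k's across V₁ × ⋯ × V_k in its neighbourhood.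
-- A leftover vertex with few neighbours in some V_i can be added to V_i; to the remaining vertices
-- apply the greedy steps again, and let V_{k+1} be the first set found.  Then the box
-- V₁ × ⋯ × V_{k+1} has K_{k+1}-density at least m^{-O(1)}.  A sub-box locally maximizing N ^ g / vol ^ (g ∸ 1),
-- where N counts cliques and g is polynomial in m, is rich again; it is exponentially small, but this
-- costs nothing because sizes do not matter, only the number of sets.  Vertices parked at V_i stay
-- with the discarded half of V_i.  Once k = r, richness and K_{r+1}-freeness leave no vertex over.

open import Defs
open import Data.Nat hiding (_⊓_)
open import Data.Nat.Properties
open import Data.Nat.DivMod using (m≡m%n+[m/n]*n; m%n<n)
open import Data.Nat.Induction using (<-wellFounded)
open import Data.Nat.Tactic.RingSolver using (solve-∀)
open import Data.Bool using (Bool; true; false; if_then_else_; _∧_; _∨_; not; T) renaming (_≟_ to _≟ᵇ_)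
open import Data.Bool.Properties using (∧-zeroʳ)
open import Data.Fin using (Fin; zero; suc) renaming (_≟_ to _≟F_)
open import Data.Fin.Properties using (any?)
open import Data.List using (List; []; _∷_; _++_; length; lookup)
open import Data.List.Properties using (length-++)
open import Data.List.Membership.Propositional.Properties using (∈-lookup)
open import Data.List.Relation.Unary.All as All using (All; []; _∷_)
open import Data.List.Relation.Unary.All.Properties using (++⁺)
open import Data.Vec using (Vec; []; _∷_; toList; zipWith; map)
open import Data.Vec.Relation.Binary.Pointwise.Inductive as PW using (Pointwise; []; _∷_)
open import Data.Vec.Relation.Unary.All using () renaming (All to Allᵥ; [] to []ᵥ; _∷_ to _∷ᵥ_)
open import Data.Product using (Σ; _×_; _,_; proj₁; proj₂)
open import Data.Sum using (_⊎_; inj₁; inj₂)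
open import Data.Unit using (⊤; tt)
open import Data.Empty using (⊥; ⊥-elim)
open import Function using (_∘_; id; const)
open import Induction.WellFounded using (Acc; acc)
open import Relation.Nullary using (¬_; yes; no)
open import Relation.Nullary.Decidable using (⌊_⌋; isYes≗does; _×-dec_)
open import Relation.Binary.PropositionalEquality hiding (sym)
import Relation.Binary.PropositionalEquality as Eq
open import Algebra.Properties.Semiring.Sum +-*-semiring
  using (sum; sum-cong-≗; ∑-distrib-+; *-distribʳ-sum)

-- Power inequalities over the natural numbers

^-distribʳ-* : ∀ n a b → (a * b) ^ n ≡ a ^ n * b ^ n
^-distribʳ-* zero a b = refl
^-distribʳ-* (suc n) a b =
  trans (cong (a * b *_) (^-distribʳ-* n a b)) (interchange a b (a ^ n) (b ^ n))
  where
  interchange : ∀ a b c d → a * b * (c * d) ≡ a * c * (b * d)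
  interchange = solve-∀

^-cancelˡ-≤ : ∀ n {a b} → a ^ suc n ≤ b ^ suc n → a ≤ b
^-cancelˡ-≤ n {a} {b} aⁿ≤bⁿ with a ≤? b
... | yes a≤b = a≤b
... | no a≰b = ⊥-elim (<⇒≱ (^-monoˡ-< (suc n) (≰⇒> a≰b)) aⁿ≤bⁿ)

cancel-≤ : ∀ {a b c} → 1 ≤ c → c * a ≤ c * b → a ≤ b
cancel-≤ {c = suc c} _ = *-cancelˡ-≤ (suc c)

n≤2^n : ∀ n → n ≤ 2 ^ n
n≤2^n zero = z≤n
n≤2^n (suc n) = begin
  1 + n              ≤⟨ +-mono-≤ (m^n>0 2 n) (n≤2^n n) ⟩
  2 ^ n + 2 ^ n      ≡⟨ cong (2 ^ n +_) (+-identityʳ (2 ^ n)) ⟨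
  2 ^ suc n          ∎
  where open ≤-Reasoning

square-≥ : ∀ x y → 2 * (x * y) ≤ x * x + y * y
square-≥ x y with ≤-total x y
... | inj₁ x≤y = subst (λ y → 2 * (x * y) ≤ x * x + y * y) (m+[n∸m]≡n x≤y) (lemma x (y ∸ x))
  where
  expand : ∀ x d → x * x + (x + d) * (x + d) ≡ 2 * (x * (x + d)) + d * d
  expand = solve-∀
  lemma : ∀ x d → 2 * (x * (x + d)) ≤ x * x + (x + d) * (x + d)
  lemma x d = subst (2 * (x * (x + d)) ≤_) (Eq.sym (expand x d)) (m≤m+n _ _)
... | inj₂ y≤x = subst (λ x → 2 * (x * y) ≤ x * x + y * y) (m+[n∸m]≡n y≤x) (lemma y (x ∸ y))
  where
  expand : ∀ y d → (y + d) * (y + d) + y * y ≡ 2 * ((y + d) * y) + d * d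
  expand = solve-∀
  lemma : ∀ y d → 2 * ((y + d) * y) ≤ (y + d) * (y + d) + y * y
  lemma y d = subst (2 * ((y + d) * y) ≤_) (Eq.sym (expand y d)) (m≤m+n _ _)

-- AM-GM for one `x` and `h` copies of `y`, kept homogeneous to avoid division. The induction
-- multiplies the previous case by `x` and applies `square-≥`; the summand added on both sides
-- stands in for a subtraction.
bernoulli : ∀ h x y → suc h * (x * y ^ h) ≤ x ^ suc h + h * y ^ suc h
bernoulli zero x y = ≤-reflexive (eq x)
  where
  eq : ∀ x → 1 * (x * 1) ≡ x * 1 + 0
  eq = solve-∀
bernoulli (suc h) x y = +-cancelʳ-≤ (x * (h * (y * Y))) _ _ (begin
  (2 + h) * (x * (y * Y)) + x * (h * (y * Y))          ≡⟨ eq₁ h x y Y ⟩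
  (suc h * Y) * (2 * (x * y))                          ≤⟨ *-monoʳ-≤ (suc h * Y) (square-≥ x y) ⟩
  (suc h * Y) * (x * x + y * y)                        ≡⟨ eq₂ h x y Y ⟩
  x * (suc h * (x * Y)) + suc h * (y * (y * Y))        ≤⟨ +-monoˡ-≤ _ (*-monoʳ-≤ x (bernoulli h x y)) ⟩
  x * (X + h * (y * Y)) + suc h * (y * (y * Y))        ≡⟨ eq₃ h x y X Y ⟩
  x * X + suc h * (y * (y * Y)) + x * (h * (y * Y))    ∎)
  where
  open ≤-Reasoning
  X = x ^ suc h
  Y = y ^ h
  eq₁ : ∀ h x y Y → (2 + h) * (x * (y * Y)) + x * (h * (y * Y)) ≡ (suc h * Y) * (2 * (x * y))
  eq₁ = solve-∀
  eq₂ : ∀ h x y Y → (suc h * Y) * (x * x + y * y) ≡ x * (suc h * (x * Y)) + suc h * (y * (y * Y))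
  eq₂ = solve-∀
  eq₃ : ∀ h x y X Y → x * (X + h * (y * Y)) + suc h * (y * (y * Y))
                    ≡ x * X + suc h * (y * (y * Y)) + x * (h * (y * Y))
  eq₃ = solve-∀

-- This is `bernoulli` at `x = h * a + b` and `y = suc h * a`, where the contribution of `h * a` on
-- the left cancels against `h * y ^ suc h`.
weighted-AM-GM : ∀ h a b → suc h ^ suc h * (a ^ h * b) ≤ (h * a + b) ^ suc h
weighted-AM-GM h a b = +-cancelʳ-≤ (h * y ^ suc h) _ _ (begin
  suc h ^ suc h * (a ^ h * b) + h * (y * y ^ h)
    ≡⟨ cong (λ p → suc h ^ suc h * (a ^ h * b) + h * (y * p)) (^-distribʳ-* h (suc h) a) ⟩
  suc h * S * (A * b) + h * (suc h * a * (S * A))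
    ≡⟨ eq h a b S A ⟩
  suc h * ((h * a + b) * (S * A))
    ≡⟨ cong (λ p → suc h * ((h * a + b) * p)) (^-distribʳ-* h (suc h) a) ⟨
  suc h * ((h * a + b) * y ^ h)
    ≤⟨ bernoulli h (h * a + b) y ⟩
  (h * a + b) ^ suc h + h * y ^ suc h
    ∎)
  where
  open ≤-Reasoning
  y = suc h * a
  S = suc h ^ h
  A = a ^ h
  eq : ∀ h a b S A → suc h * S * (A * b) + h * (suc h * a * (S * A)) ≡ suc h * ((h * a + b) * (S * A))
  eq = solve-∀

-- With `a = suc b` this is (1 - 1/a)^a ≤ 1/2; `bernoulli` gives it with `b ^ b` to spare.
2b^a≤a^a : ∀ b → 2 * b ^ suc b ≤ suc b ^ suc b
2b^a≤a^a b = +-cancelʳ-≤ (b * b ^ suc b) _ _ (begin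
  2 * (b * B) + b * (b * B)                  ≤⟨ m≤n+m _ B ⟩
  B + (2 * (b * B) + b * (b * B))            ≡⟨ eq b B ⟩
  suc b * (suc b * B)                        ≤⟨ bernoulli b (suc b) b ⟩
  suc b ^ suc b + b * b ^ suc b              ∎)
  where
  open ≤-Reasoning
  B = b ^ b
  eq : ∀ b B → B + (2 * (b * B) + b * (b * B)) ≡ suc b * (suc b * B)
  eq = solve-∀

geometric-decay : ∀ b l → b ^ (suc b * l) * 2 ^ l ≤ suc b ^ (suc b * l)
geometric-decay b l = begin
  b ^ (suc b * l) * 2 ^ l        ≡⟨ cong (_* 2 ^ l) (^-*-assoc b (suc b) l) ⟨
  (b ^ suc b) ^ l * 2 ^ l        ≡⟨ ^-distribʳ-* l (b ^ suc b) 2 ⟨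
  (b ^ suc b * 2) ^ l            ≡⟨ cong (_^ l) (*-comm (b ^ suc b) 2) ⟩
  (2 * b ^ suc b) ^ l            ≤⟨ ^-monoˡ-≤ l (2b^a≤a^a b) ⟩
  (suc b ^ suc b) ^ l            ≡⟨ ^-*-assoc (suc b) (suc b) l ⟩
  suc b ^ (suc b * l)            ∎
  where open ≤-Reasoning

factorˡ-pos : ∀ {a b} → 1 ≤ a * b → 1 ≤ a
factorˡ-pos {suc a} _ = s≤s z≤n

factorʳ-pos : ∀ a {b} → 1 ≤ a * b → 1 ≤ b
factorʳ-pos a {b} 1≤ab = factorˡ-pos (subst (1 ≤_) (*-comm a b) 1≤ab)

pos-^ : ∀ {a} n → 1 ≤ a → 1 ≤ a ^ n
pos-^ {suc a} n _ = m^n>0 (suc a) n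

-- The test `gain` is linear in `N′` and `v′`, so it can be added up over the boxes of `sweep`. By
-- weighted AM-GM it keeps N^(h+1) / v^h from decreasing; together with `N′ ≤ N` it forces `v′ < v`,
-- which makes the loop terminate.
potential-step : ∀ h {N v N′ v′} → 1 ≤ v → N′ ≤ N → N * h * v′ + N * v < suc h * v * N′ →
  v′ < v × 1 ≤ N′ × v′ ^ h * N ^ suc h ≤ v ^ h * N′ ^ suc h
potential-step h {N} {v} {N′} {v′} 1≤v N′≤N gain = v′<v , 1≤N′ , increase
  where
  open ≤-Reasoning
  1≤N′ : 1 ≤ N′
  1≤N′ = factorʳ-pos (suc h * v) (≤-trans (s≤s z≤n) gain)
  v′<v : v′ < v
  v′<v with v′ <? v
  ... | yes lt = lt
  ... | no ¬lt = ⊥-elim (<⇒≱ gain (begin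
    suc h * v * N′          ≤⟨ *-monoʳ-≤ (suc h * v) N′≤N ⟩
    suc h * v * N           ≡⟨ eq h v N ⟩
    N * h * v + N * v       ≤⟨ +-monoˡ-≤ (N * v) (*-monoʳ-≤ (N * h) (≮⇒≥ ¬lt)) ⟩
    N * h * v′ + N * v      ∎))
    where
    eq : ∀ h v N → suc h * v * N ≡ N * h * v + N * v
    eq = solve-∀
  increase : v′ ^ h * N ^ suc h ≤ v ^ h * N′ ^ suc h
  increase = cancel-≤ {c = suc h ^ suc h * v} (*-mono-≤ (pos-^ {suc h} (suc h) (s≤s z≤n)) 1≤v) (begin
    suc h ^ suc h * v * (v′ ^ h * N ^ suc h)          ≡⟨ eq₁ (suc h ^ suc h) v (v′ ^ h) (N ^ suc h) ⟩
    N ^ suc h * (suc h ^ suc h * (v′ ^ h * v))        ≤⟨ *-monoʳ-≤ (N ^ suc h) (weighted-AM-GM h v′ v) ⟩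
    N ^ suc h * (h * v′ + v) ^ suc h                  ≡⟨ ^-distribʳ-* (suc h) N (h * v′ + v) ⟨
    (N * (h * v′ + v)) ^ suc h                        ≡⟨ cong (_^ suc h) (eq₂ N h v′ v) ⟩
    (N * h * v′ + N * v) ^ suc h                      ≤⟨ ^-monoˡ-≤ (suc h) (<⇒≤ gain) ⟩
    (suc h * v * N′) ^ suc h                          ≡⟨ ^-distribʳ-* (suc h) (suc h * v) N′ ⟩
    (suc h * v) ^ suc h * N′ ^ suc h                  ≡⟨ cong (_* N′ ^ suc h) (^-distribʳ-* (suc h) (suc h) v) ⟩
    suc h ^ suc h * (v * v ^ h) * N′ ^ suc h          ≡⟨ eq₃ (suc h ^ suc h) v (v ^ h) (N′ ^ suc h) ⟩
    suc h ^ suc h * v * (v ^ h * N′ ^ suc h)          ∎)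
    where
    eq₁ : ∀ S v x y → S * v * (x * y) ≡ y * (S * (x * v))
    eq₁ = solve-∀
    eq₂ : ∀ N h v′ v → N * (h * v′ + v) ≡ N * h * v′ + N * v
    eq₂ = solve-∀
    eq₃ : ∀ S v x y → S * (v * x) * y ≡ S * v * (x * y)
    eq₃ = solve-∀

-- `total` is what remains when no discarded box passes the gain test. Since `h = 2 * (r * w)` and
-- `v ≤ w * v′`, the term `N * h * v′` is at least `2 * r * N * v` and outweighs the error
-- `k * (N * v)`; hence the sub-box holds at least `N / suc h` cliques.
dense-subbox : ∀ {r k w d N v N′ v′} → let h = 2 * (r * w) in
  1 ≤ v → k ≤ r → v ≤ w * v′ → v ≤ N * d →
  suc h * v * N + N * h * v′ ≤ suc h * v * N′ + N * h * v + k * (N * v) →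
  v ≤ N′ * (suc h * d)
dense-subbox {r} {k} {w} {d} {N} {v} {N′} {v′} 1≤v k≤r v≤wv′ v≤Nd total = begin
  v                      ≤⟨ v≤Nd ⟩
  N * d                  ≤⟨ *-monoˡ-≤ d N≤gN′ ⟩
  suc h * N′ * d         ≡⟨ eq₀ (suc h) N′ d ⟩
  N′ * (suc h * d)       ∎
  where
  open ≤-Reasoning
  h = 2 * (r * w)
  eq₀ : ∀ g N d → g * N * d ≡ N * (g * d)
  eq₀ = solve-∀
  eq₁ : ∀ r w v N → v * N + N * (2 * (r * w)) * v + r * (N * v) + r * (N * v)
                  ≡ suc (2 * (r * w)) * v * N + 2 * r * N * v
  eq₁ = solve-∀
  eq₂ : ∀ r w v N X → X + 2 * r * N * (w * v) ≡ X + N * (2 * (r * w)) * v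
  eq₂ = solve-∀
  eq₃ : ∀ X Y Z → X + Y + Z ≡ X + (Y + Z)
  eq₃ = solve-∀
  eq₄ : ∀ h v N′ → suc h * v * N′ ≡ v * (suc h * N′)
  eq₄ = solve-∀
  N≤gN′ : N ≤ suc h * N′
  N≤gN′ = cancel-≤ 1≤v (+-cancelʳ-≤ (N * h * v + r * (N * v)) _ _ (begin
    v * N + (N * h * v + r * (N * v))                    ≤⟨ m≤m+n _ _ ⟩
    v * N + (N * h * v + r * (N * v)) + r * (N * v)      ≡⟨ cong (_+ r * (N * v)) (eq₃ (v * N) _ _) ⟨
    v * N + N * h * v + r * (N * v) + r * (N * v)        ≡⟨ eq₁ r w v N ⟩
    suc h * v * N + 2 * r * N * v                        ≤⟨ +-monoʳ-≤ (suc h * v * N) (*-monoʳ-≤ (2 * r * N) v≤wv′) ⟩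
    suc h * v * N + 2 * r * N * (w * v′)                 ≡⟨ eq₂ r w v′ N (suc h * v * N) ⟩
    suc h * v * N + N * h * v′                           ≤⟨ total ⟩
    suc h * v * N′ + N * h * v + k * (N * v)             ≤⟨ +-monoʳ-≤ _ (*-monoˡ-≤ (N * v) k≤r) ⟩
    suc h * v * N′ + N * h * v + r * (N * v)             ≡⟨ eq₃ (suc h * v * N′) _ _ ⟩
    suc h * v * N′ + (N * h * v + r * (N * v))           ≡⟨ cong (_+ (N * h * v + r * (N * v))) (eq₄ h v N′) ⟩
    v * (suc h * N′) + (N * h * v + r * (N * v))         ∎))

-- Vertex sets, their sizes and their subsets

private
  variable
    n k : ℕ

VSet : ℕ → Set
VSet n = Fin n → Bool

infixr 7 _∩_ _∖_
infixr 6 _∪_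
infix 4 _⊆_

_∩_ _∪_ _∖_ : VSet n → VSet n → VSet n
(A ∩ B) u = A u ∧ B u
(A ∪ B) u = A u ∨ B u
(A ∖ B) u = A u ∧ not (B u)

_⊆_ : VSet n → VSet n → Set
A ⊆ B = ∀ u → A u ≡ true → B u ≡ true

ind : Bool → ℕ
ind b = if b then 1 else 0

ind-mono : ∀ {a b} → (a ≡ true → b ≡ true) → ind a ≤ ind b
ind-mono {false} _ = z≤n
ind-mono {true} {b} a⇒b rewrite a⇒b refl = ≤-refl

ind-split : ∀ a b → ind a ≡ ind (a ∧ b) + ind (a ∧ not b)
ind-split false b = refl
ind-split true false = refl
ind-split true true = refl

ind-∧ : ∀ a b → ind (a ∧ b) ≡ ind a * ind b
ind-∧ false b = refl
ind-∧ true b = Eq.sym (+-identityʳ (ind b))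

∧-true : ∀ {a b} → a ∧ b ≡ true → a ≡ true × b ≡ true
∧-true {true} b≡true = refl , b≡true

∧-intro : ∀ {a b} → a ≡ true → b ≡ true → a ∧ b ≡ true
∧-intro refl b≡true = b≡true

∨-true : ∀ {a b} → a ∨ b ≡ true → a ≡ true ⊎ b ≡ true
∨-true {true} _ = inj₁ refl
∨-true {false} b≡true = inj₂ b≡true

not-true : ∀ {a} → ¬ a ≡ true → a ≡ false
not-true {true} a≢true = ⊥-elim (a≢true refl)
not-true {false} _ = refl

sum-mono : (f g : Fin n → ℕ) → (∀ u → f u ≤ g u) → sum f ≤ sum g
sum-mono {zero} f g f≤g = z≤n
sum-mono {suc n} f g f≤g = +-mono-≤ (f≤g zero) (sum-mono (f ∘ suc) (g ∘ suc) (f≤g ∘ suc))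

sum-pos : (f : Fin n → ℕ) → 1 ≤ sum f → Σ (Fin n) λ u → 1 ≤ f u
sum-pos {suc n} f 1≤ with f zero in eq
... | suc _ = zero , subst (1 ≤_) (Eq.sym eq) (s≤s z≤n)
... | zero = let (u , 1≤f) = sum-pos (f ∘ suc) 1≤ in suc u , 1≤f

count-sum : (S : VSet n) → count S ≡ sum (ind ∘ S)
count-sum {zero} S = refl
count-sum {suc n} S = cong (ind (S zero) +_) (count-sum (S ∘ suc))

count-mono : (A B : VSet n) → A ⊆ B → count A ≤ count B
count-mono A B A⊆B rewrite count-sum A | count-sum B = sum-mono _ _ λ u → ind-mono (A⊆B u)

count-split : (A B : VSet n) → count A ≡ count (A ∩ B) + count (A ∖ B)
count-split A B rewrite count-sum A | count-sum (A ∩ B) | count-sum (A ∖ B) =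
  trans (sum-cong-≗ (λ u → ind-split (A u) (B u))) (∑-distrib-+ (ind ∘ (A ∩ B)) (ind ∘ (A ∖ B)))

count-cover : (A B C : VSet n) → (∀ u → A u ≡ true → B u ≡ true ⊎ C u ≡ true) → count A ≤ count B + count C
count-cover A B C cover rewrite count-sum A | count-sum B | count-sum C =
  ≤-trans (sum-mono _ _ (λ u → pointwise (cover u))) (≤-reflexive (∑-distrib-+ (ind ∘ B) (ind ∘ C)))
  where
  pointwise : ∀ {a b c} → (a ≡ true → b ≡ true ⊎ c ≡ true) → ind a ≤ ind b + ind c
  pointwise {false} _ = z≤n
  pointwise {true} {b} {c} cov with cov refl
  ... | inj₁ refl = s≤s z≤n
  ... | inj₂ refl = m≤n+m 1 (ind b)

count-member : (S : VSet n) (u : Fin n) → S u ≡ true → 1 ≤ count S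
count-member S zero eq rewrite eq = s≤s z≤n
count-member S (suc u) eq = ≤-trans (count-member (S ∘ suc) u eq) (m≤n+m _ (ind (S zero)))

count-∖ : (A B : VSet n) → B ⊆ A → count A ≡ count B + count (A ∖ B)
count-∖ A B B⊆A = trans (count-split A B) (cong (_+ count (A ∖ B))
  (≤-antisym (count-mono (A ∩ B) B (λ u eq → proj₂ (∧-true {A u} eq))) (count-mono B (A ∩ B) (λ u eq → ∧-intro (B⊆A u eq) eq))))

member? : (S : VSet n) → (Σ (Fin n) λ u → S u ≡ true) ⊎ (∀ u → S u ≡ false)
member? S with any? (λ u → S u ≟ᵇ true)
... | yes found = inj₁ found
... | no none = inj₂ λ u → not-true λ eq → none (u , eq)

subset-of-size : (S : VSet n) (j : ℕ) → j ≤ count S → Σ (VSet n) λ A → A ⊆ S × count A ≡ j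
subset-of-size {zero} S zero _ = S , (λ _ → id) , refl
subset-of-size {suc n} S j j≤ with S zero in eq
subset-of-size {suc n} S j j≤ | false =
  let (A , A⊆S , |A|) = subset-of-size (S ∘ suc) j j≤
  in (λ { zero → false ; (suc u) → A u }) , (λ { (suc u) → A⊆S u }) , |A|
subset-of-size {suc n} S zero j≤ | true =
  let (A , A⊆S , |A|) = subset-of-size (S ∘ suc) 0 z≤n
  in (λ { zero → false ; (suc u) → A u }) , (λ { (suc u) → A⊆S u }) , |A|
subset-of-size {suc n} S (suc j) j≤ | true =
  let (A , A⊆S , |A|) = subset-of-size (S ∘ suc) j (s≤s⁻¹ j≤)
  in (λ { zero → true ; (suc u) → A u }) , (λ { zero _ → eq ; (suc u) → A⊆S u }) , cong suc |A|

-- `j` is the floor of half of `c`. The bound `c ≤ 3 * j` is tight at `c = 3` and would fail at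
-- `c = 1`, where the floor is 0.
halve : ∀ c → 2 ≤ c → Σ ℕ λ j → 2 * j ≤ c × c ≤ 3 * j
halve 1 (s≤s ())
halve 2 _ = 1 , ≤-refl , s≤s (s≤s z≤n)
halve 3 _ = 1 , s≤s (s≤s z≤n) , ≤-refl
halve (suc (suc c@(suc (suc _)))) _ =
  let (j , lo , hi) = halve c (s≤s (s≤s z≤n))
  in suc j
   , subst (_≤ 2 + c) (double j) (s≤s (s≤s lo))
   , ≤-trans (s≤s (s≤s hi)) (subst (2 + 3 * j ≤_) (triple j) (n≤1+n _))
  where
  double : ∀ j → 2 + 2 * j ≡ 2 * suc j
  double = solve-∀
  triple : ∀ j → 3 + 3 * j ≡ 3 * suc j
  triple = solve-∀

half-subset : (X : VSet n) → 2 ≤ count X → Σ (VSet n) λ A → A ⊆ X × 2 * count A ≤ count X × count X ≤ 3 * count A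
half-subset X 2≤ =
  let (j , lo , hi) = halve (count X) 2≤
      (A , A⊆X , |A|) = subset-of-size X j (≤-trans (m≤m+n j _) lo)
  in A , A⊆X , subst (λ j → 2 * j ≤ count X) (Eq.sym |A|) lo , subst (λ j → count X ≤ 3 * j) (Eq.sym |A|) hi

-- Lists of vertex sets as partitions

mult : List (VSet n) → Fin n → ℕ
mult [] u = 0
mult (S ∷ Ss) u = ind (S u) + mult Ss u

mult-++ : (Ss Ts : List (VSet n)) (u : Fin n) → mult (Ss ++ Ts) u ≡ mult Ss u + mult Ts u
mult-++ [] Ts u = refl
mult-++ (S ∷ Ss) Ts u = trans (cong (ind (S u) +_) (mult-++ Ss Ts u)) (Eq.sym (+-assoc (ind (S u)) _ _))

mult-0 : (Ss : List (VSet n)) (u : Fin n) → mult Ss u ≡ 0 → (c : Fin (length Ss)) → lookup Ss c u ≡ false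
mult-0 (S ∷ Ss) u eq c with S u in Su
mult-0 (S ∷ Ss) u eq zero | false = Su
mult-0 (S ∷ Ss) u eq (suc c) | false = mult-0 Ss u eq c

⌊suc≟suc⌋ : (i j : Fin k) → ⌊ suc i ≟F suc j ⌋ ≡ ⌊ i ≟F j ⌋
⌊suc≟suc⌋ i j = trans (isYes≗does (suc i ≟F suc j)) (Eq.sym (isYes≗does (i ≟F j)))

-- A list with `mult` equal to 1 everywhere is a partition in which empty sets may occur.
-- Multiplicity one excludes a second set containing `u`, so the index found decides membership in
-- every set of the list.
class-index : (Ss : List (VSet n)) (u : Fin n) → mult Ss u ≡ 1 →
  Σ (Fin (length Ss)) λ i → ∀ c → ⌊ i ≟F c ⌋ ≡ lookup Ss c u
class-index (S ∷ Ss) u eq with S u in Su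
... | true = zero , λ { zero → Eq.sym Su ; (suc c) → Eq.sym (mult-0 Ss u (suc-injective eq) c) }
... | false =
  let (i , spec) = class-index Ss u eq
  in suc i , λ { zero → Eq.sym Su ; (suc c) → trans (⌊suc≟suc⌋ i c) (spec c) }

-- Boxes and functions additive in each coordinate

Additive : ∀ k → (Vec (VSet n) k → ℕ) → Set
Additive zero f = ⊤
Additive (suc k) f = (∀ U W Vs → f (U ∷ Vs) ≡ f (U ∩ W ∷ Vs) + f (U ∖ W ∷ Vs)) × (∀ V → Additive k (f ∘ (V ∷_)))

additive-sum : ∀ {m} k (w : Fin m → ℕ) (F : Fin m → Vec (VSet n) k → ℕ) → (∀ v → Additive k (F v)) →
  Additive k (λ Vs → sum (λ v → w v * F v Vs))
additive-sum zero w F add = tt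
additive-sum (suc k) w F add =
  (λ U W Vs → trans (sum-cong-≗ (λ v → trans (cong (w v *_) (proj₁ (add v) U W Vs)) (*-distribˡ-+ (w v) (F v (U ∩ W ∷ Vs)) _)))
                    (∑-distrib-+ (λ v → w v * F v (U ∩ W ∷ Vs)) _)) ,
  (λ V → additive-sum k w (λ v → F v ∘ (V ∷_)) (λ v → proj₂ (add v) V))

fibre-split : (U W : VSet n) (φ : Fin n → ℕ) →
  sum (λ v → ind (U v) * φ v) ≡ sum (λ v → ind ((U ∩ W) v) * φ v) + sum (λ v → ind ((U ∖ W) v) * φ v)
fibre-split U W φ = trans
  (sum-cong-≗ λ v → trans (cong (_* φ v) (ind-split (U v) (W v))) (*-distribʳ-+ (φ v) (ind (U v ∧ W v)) _))
  (∑-distrib-+ (λ v → ind ((U ∩ W) v) * φ v) _)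

_⊓_ : Vec (VSet n) k → Vec (VSet n) k → Vec (VSet n) k
_⊓_ = zipWith _∩_

_⊑_ : Vec (VSet n) k → Vec (VSet n) k → Set
_⊑_ = Pointwise _⊆_

⊑-refl : (Vs : Vec (VSet n) k) → Vs ⊑ Vs
⊑-refl Vs = PW.refl (λ _ → id)

⊑-trans : {Us Vs Ws : Vec (VSet n) k} → Us ⊑ Vs → Vs ⊑ Ws → Us ⊑ Ws
⊑-trans = PW.trans (λ A⊆B B⊆C u → B⊆C u ∘ A⊆B u)

∩-⊆ˡ : (A B : VSet n) → A ∩ B ⊆ A
∩-⊆ˡ A B u = proj₁ ∘ ∧-true {A u}

∖-⊆ : (A B : VSet n) → A ∖ B ⊆ A
∖-⊆ A B u = proj₁ ∘ ∧-true {A u}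

-- Passing from B to B ⊓ W one coordinate at a time discards k boxes.
sweep : ∀ {k} (f h : Vec (VSet n) k → ℕ) → Additive k f → Additive k h → (α β γ : ℕ) (B W : Vec (VSet n) k) →
  (Σ (Vec (VSet n) k) λ B′ → B′ ⊑ B × f B′ ≤ f B × β * h B′ + γ < α * f B′) ⊎
  (α * f B + β * h (B ⊓ W) ≤ α * f (B ⊓ W) + β * h B + k * γ)
sweep {k = zero} f h _ _ α β γ [] [] = inj₂ (m≤m+n _ 0)
sweep {k = suc k} f h addf addh α β γ (V ∷ Vs) (U ∷ Us)
  -- A discarded slab that passes the test is returned. Otherwise its failed test is an inequality
  -- which, by additivity, adds to the one found recursively inside `V ∩ U`; each coordinate
  -- contributes one `γ`.
  with β * h (V ∖ U ∷ Vs) + γ <? α * f (V ∖ U ∷ Vs)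
... | yes found = inj₁ (V ∖ U ∷ Vs , ∖-⊆ V U ∷ ⊑-refl Vs
      , subst (f (V ∖ U ∷ Vs) ≤_) (Eq.sym (proj₁ addf V U Vs)) (m≤n+m _ _) , found)
... | no ¬found
  with sweep (f ∘ (V ∩ U ∷_)) (h ∘ (V ∩ U ∷_)) (proj₂ addf _) (proj₂ addh _) α β γ Vs Us
...   | inj₁ (B′ , B′⊑ , f≤ , found) = inj₁ (V ∩ U ∷ B′ , ∩-⊆ˡ V U ∷ B′⊑
        , ≤-trans f≤ (subst (f (V ∩ U ∷ Vs) ≤_) (Eq.sym (proj₁ addf V U Vs)) (m≤m+n _ _)) , found)
...   | inj₂ rest = inj₂ (begin
        α * f (V ∷ Vs) + β * h⊓                     ≡⟨ cong (λ x → α * x + β * h⊓) (proj₁ addf V U Vs) ⟩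
        α * (f₁ + f₂) + β * h⊓                      ≡⟨ eq₁ α β f₁ f₂ h⊓ ⟩
        (α * f₁ + β * h⊓) + α * f₂                  ≤⟨ +-mono-≤ rest (≮⇒≥ ¬found) ⟩
        (α * f⊓ + β * h₁ + k * γ) + (β * h₂ + γ)    ≡⟨ eq₂ α β γ k f⊓ h₁ h₂ ⟩
        α * f⊓ + β * (h₁ + h₂) + suc k * γ          ≡⟨ cong (λ x → α * f⊓ + β * x + suc k * γ) (proj₁ addh V U Vs) ⟨
        α * f⊓ + β * h (V ∷ Vs) + suc k * γ         ∎)
  where
  open ≤-Reasoning
  f₁ = f (V ∩ U ∷ Vs)
  f₂ = f (V ∖ U ∷ Vs)
  h₁ = h (V ∩ U ∷ Vs)
  h₂ = h (V ∖ U ∷ Vs)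
  f⊓ = f ((V ∷ Vs) ⊓ (U ∷ Us))
  h⊓ = h ((V ∷ Vs) ⊓ (U ∷ Us))
  eq₁ : ∀ α β f₁ f₂ h → α * (f₁ + f₂) + β * h ≡ (α * f₁ + β * h) + α * f₂
  eq₁ = solve-∀
  eq₂ : ∀ α β γ k f h₁ h₂ → (α * f + β * h₁ + k * γ) + (β * h₂ + γ) ≡ α * f + β * (h₁ + h₂) + suc k * γ
  eq₂ = solve-∀

vol : Vec (VSet n) k → ℕ
vol [] = 1
vol (V ∷ Vs) = count V * vol Vs

additive-scale : ∀ k c (f : Vec (VSet n) k → ℕ) → Additive k f → Additive k (λ Vs → c * f Vs)
additive-scale zero c f add = tt
additive-scale (suc k) c f (split , add) =
  (λ U W Vs → trans (cong (c *_) (split U W Vs)) (*-distribˡ-+ c _ _)) , λ V → additive-scale k c _ (add V)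

vol-additive : ∀ k → Additive {n} k vol
vol-additive zero = tt
vol-additive (suc k) =
  (λ U W Vs → trans (cong (_* vol Vs) (count-split U W)) (*-distribʳ-+ (vol Vs) (count (U ∩ W)) _)) ,
  (λ V → additive-scale k (count V) vol (vol-additive k))

vol-mono : {As Bs : Vec (VSet n) k} → As ⊑ Bs → vol As ≤ vol Bs
vol-mono [] = ≤-refl
vol-mono (A⊆B ∷ As⊑Bs) = *-mono-≤ (count-mono _ _ A⊆B) (vol-mono As⊑Bs)

vol-pos : {Vs : Vec (VSet n) k} → Allᵥ (λ V → 1 ≤ count V) Vs → 1 ≤ vol Vs
vol-pos []ᵥ = ≤-refl
vol-pos (1≤ ∷ᵥ 1≤s) = *-mono-≤ 1≤ (vol-pos 1≤s)

vol-fibres : (V : VSet n) (Vs : Vec (VSet n) k) → vol (V ∷ Vs) ≡ sum (λ v → ind (V v) * vol Vs)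
vol-fibres V Vs = trans (cong (_* vol Vs) (count-sum V)) (*-distribʳ-sum (vol Vs) (ind ∘ V))

-- Every coordinate of `As` lies inside that of `Bs`, so the other coordinates can only add to the
-- loss of volume, and `D` bounds the loss in any single one.
coordinate-bound : ∀ {D} {As Bs : Vec (VSet n) k} → As ⊑ Bs → 1 ≤ vol Bs → vol Bs ≤ vol As * D →
  Pointwise (λ A B → count B ≤ count A * D) As Bs
coordinate-bound [] _ _ = []
coordinate-bound {D = D} {A ∷ As} {B ∷ Bs} (A⊆B ∷ As⊑Bs) 1≤ bound =
  cancel-≤ 1≤Bs (begin
    vol Bs * count B          ≡⟨ *-comm (vol Bs) (count B) ⟩
    count B * vol Bs          ≤⟨ bound ⟩
    count A * vol As * D      ≤⟨ *-monoˡ-≤ D (*-monoʳ-≤ (count A) (vol-mono As⊑Bs)) ⟩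
    count A * vol Bs * D      ≡⟨ eq (count A) (vol Bs) D ⟩
    vol Bs * (count A * D)    ∎)
  ∷ coordinate-bound As⊑Bs 1≤Bs (cancel-≤ 1≤B (begin
    count B * vol Bs          ≤⟨ bound ⟩
    count A * vol As * D      ≤⟨ *-monoˡ-≤ D (*-monoˡ-≤ (vol As) (count-mono A B A⊆B)) ⟩
    count B * vol As * D      ≡⟨ *-assoc (count B) (vol As) D ⟩
    count B * (vol As * D)    ∎))
  where
  open ≤-Reasoning
  eq : ∀ a b D → a * b * D ≡ b * (a * D)
  eq = solve-∀
  1≤B : 1 ≤ count B
  1≤B = factorˡ-pos 1≤
  1≤Bs : 1 ≤ vol Bs
  1≤Bs = factorʳ-pos (count B) 1≤

mult-mono : {Hs Vs : Vec (VSet n) k} → Hs ⊑ Vs → ∀ u → mult (toList Hs) u ≤ mult (toList Vs) u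
mult-mono [] u = z≤n
mult-mono (H⊆V ∷ Hs⊑Vs) u = +-mono-≤ (ind-mono (H⊆V u)) (mult-mono Hs⊑Vs u)

ind-⊆ : ∀ {a b} → (b ≡ true → a ≡ true) → ind (a ∧ not b) + ind b ≡ ind a
ind-⊆ {false} {false} _ = refl
ind-⊆ {false} {true} b⇒a with b⇒a refl
... | ()
ind-⊆ {true} {false} _ = refl
ind-⊆ {true} {true} _ = refl

mult-∖ : {Hs Vs : Vec (VSet n) k} → Hs ⊑ Vs → ∀ u →
  mult (toList (zipWith _∖_ Vs Hs)) u + mult (toList Hs) u ≡ mult (toList Vs) u
mult-∖ [] u = refl
mult-∖ {Hs = H ∷ Hs} {V ∷ Vs} (H⊆V ∷ Hs⊑Vs) u =
  trans (interchange (ind (V u ∧ not (H u))) _ (ind (H u)) _) (cong₂ _+_ (ind-⊆ (H⊆V u)) (mult-∖ Hs⊑Vs u))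
  where
  interchange : ∀ a b c d → a + b + (c + d) ≡ a + c + (b + d)
  interchange = solve-∀

-- Cliques and sparse sets

module _ {n : ℕ} (G : Graph n) where

  -- Vertices are chosen coordinate by coordinate while `X` shrinks to their common neighbourhood.
  -- Thus `cliques (const true)` counts the K_k's across a box, and `cliques (adj G x)` those in the
  -- neighbourhood of `x`.
  cliques : ∀ {k} → VSet n → Vec (VSet n) k → ℕ
  cliques X [] = 1
  cliques X (V ∷ Vs) = sum (λ v → ind (V v) * (ind (X v) * cliques (X ∩ adj G v) Vs))

  cliques-additive : ∀ k X → Additive k (cliques X)
  cliques-additive zero X = tt
  cliques-additive (suc k) X =
    (λ U W Vs → fibre-split U W (λ v → ind (X v) * cliques (X ∩ adj G v) Vs)) ,
    (λ V → additive-sum k (ind ∘ V) (λ v Vs → ind (X v) * cliques (X ∩ adj G v) Vs)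
             (λ v → additive-scale k (ind (X v)) (cliques (X ∩ adj G v)) (cliques-additive k (X ∩ adj G v))))

  -- Comparing A ∩ X with B ∩ Y lets a neighbourhood condition move from the coordinates to the
  -- ambient set, as in `restricted-cliques`, and it survives the recursion, where both ambient sets
  -- shrink.
  cliques-mono : ∀ {X Y} {As Bs : Vec (VSet n) k} →
    Pointwise (λ A B → ∀ u → A u ≡ true → X u ≡ true → B u ≡ true × Y u ≡ true) As Bs →
    cliques X As ≤ cliques Y Bs
  cliques-mono [] = ≤-refl
  cliques-mono {X = X} {Y} {A ∷ As} {B ∷ Bs} (A⇒B ∷ As⇒Bs) = sum-mono _ _ λ v →
    term (A⇒B v) (cliques-mono {X = X ∩ adj G v} {Y ∩ adj G v} (PW.map (restrict v) As⇒Bs))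
    where
    restrict : ∀ v {A B : VSet n} → (∀ u → A u ≡ true → X u ≡ true → B u ≡ true × Y u ≡ true) →
      ∀ u → A u ≡ true → (X ∩ adj G v) u ≡ true → B u ≡ true × (Y ∩ adj G v) u ≡ true
    restrict v A⇒B u Au XNu with ∧-true {X u} XNu
    ... | Xu , Nu = proj₁ (A⇒B u Au Xu) , ∧-intro (proj₂ (A⇒B u Au Xu)) Nu
    term : ∀ {a b x y c d} → (a ≡ true → x ≡ true → b ≡ true × y ≡ true) → c ≤ d →
      ind a * (ind x * c) ≤ ind b * (ind y * d)
    term {false} _ _ = z≤n
    term {true} {x = false} _ _ = z≤n
    term {true} {x = true} imp c≤d with imp refl refl
    ... | refl , refl = +-monoˡ-≤ 0 (+-monoˡ-≤ 0 c≤d)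

  cliques≤vol : ∀ {k} X (Vs : Vec (VSet n) k) → cliques X Vs ≤ vol Vs
  cliques≤vol X [] = ≤-refl
  cliques≤vol X (V ∷ Vs) = ≤-trans
    (sum-mono _ _ λ v → *-monoʳ-≤ (ind (V v)) (term (X v) (cliques≤vol (X ∩ adj G v) Vs)))
    (≤-reflexive (Eq.sym (vol-fibres V Vs)))
    where
    term : ∀ x {c d} → c ≤ d → ind x * c ≤ d
    term false _ = z≤n
    term true c≤d = ≤-trans (≤-reflexive (+-identityʳ _)) c≤d

  -- Turns richness into density with one more coordinate: when `V` consists of misfits of `Vs`, the
  -- hypothesis is richness of `Vs`, and it is summed over `V`.
  vol≤cliques-cons : ∀ {k} c (V : VSet n) (Vs : Vec (VSet n) k) →
    (∀ v → V v ≡ true → vol Vs ≤ cliques (adj G v) Vs * c) →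
    vol (V ∷ Vs) ≤ cliques (const true) (V ∷ Vs) * c
  vol≤cliques-cons c V Vs rich = begin
    vol (V ∷ Vs)                                                    ≡⟨ vol-fibres V Vs ⟩
    sum (λ v → ind (V v) * vol Vs)                                  ≤⟨ sum-mono _ _ (λ v → term (V v) (rich v)) ⟩
    sum (λ v → ind (V v) * (1 * cliques (adj G v) Vs) * c)          ≡⟨ *-distribʳ-sum c (λ v → ind (V v) * (1 * cliques (adj G v) Vs)) ⟨
    cliques (const true) (V ∷ Vs) * c                               ∎
    where
    open ≤-Reasoning
    term : ∀ a {x y} → (a ≡ true → x ≤ y * c) → ind a * x ≤ ind a * (1 * y) * c
    term false _ = z≤n
    term true {x} {y} le = subst₂ _≤_ (Eq.sym (+-identityʳ x)) (eq y c) (le refl)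
      where
      eq : ∀ y c → y * c ≡ 1 * (1 * y) * c
      eq = solve-∀

  Clique : ℕ → VSet n → Set
  Clique zero X = ⊤
  Clique (suc j) X = Σ (Fin n) λ v → X v ≡ true × Clique j (X ∩ adj G v)

  clique-mono : ∀ j {X Y} → X ⊆ Y → Clique j X → Clique j Y
  clique-mono zero X⊆Y _ = tt
  clique-mono (suc j) {X} X⊆Y (v , Xv , rest) =
    v , X⊆Y v Xv , clique-mono j (λ u eq → let (Xu , Nu) = ∧-true {X u} eq in ∧-intro (X⊆Y u Xu) Nu) rest

  cliques-clique : ∀ {k} X (Vs : Vec (VSet n) k) → 1 ≤ cliques X Vs → Clique k X
  cliques-clique X [] _ = tt
  cliques-clique X (V ∷ Vs) 1≤ =
    let (v , pos) = sum-pos _ 1≤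
        (Xv , rest) = factors (V v) (X v) pos
    in v , Xv , cliques-clique (X ∩ adj G v) Vs rest
    where
    factors : ∀ a b {c} → 1 ≤ ind a * (ind b * c) → b ≡ true × 1 ≤ c
    factors true true 1≤c = refl , ≤-trans 1≤c (≤-reflexive (trans (+-identityʳ _) (+-identityʳ _)))

  clique-embedding : ∀ j X → Clique j X → Σ (Fin j → Fin n) λ g →
    (∀ i → X (g i) ≡ true) × (∀ i i′ → i ≢ i′ → adj G (g i) (g i′) ≡ true)
  clique-embedding zero X _ = (λ ()) , (λ ()) , (λ ())
  clique-embedding (suc j) X (v , Xv , rest) =
    let (g , inside , adjacent) = clique-embedding j (X ∩ adj G v) rest
    in (λ { zero → v ; (suc i) → g i })
     , (λ { zero → Xv ; (suc i) → proj₁ (∧-true {X (g i)} (inside i)) })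
     , λ { zero zero i≢i → ⊥-elim (i≢i refl)
         ; zero (suc i) _ → proj₂ (∧-true {X (g i)} (inside i))
         ; (suc i) zero _ → trans (sym G (g i) v) (proj₂ (∧-true {X (g i)} (inside i)))
         ; (suc i) (suc i′) i≢i′ → adjacent i i′ (i≢i′ ∘ cong suc) }

  KFree⇒¬Clique : ∀ j → KFree j G → ¬ Clique j (const true)
  KFree⇒¬Clique j free clique =
    let (g , _ , adjacent) = clique-embedding j (const true) clique
    in free (g , (λ i i′ → injective g adjacent i i′) , adjacent)
    where
    injective : (g : Fin j → Fin n) → (∀ i i′ → i ≢ i′ → adj G (g i) (g i′) ≡ true) →
      ∀ i i′ → g i ≡ g i′ → i ≡ i′
    injective g adjacent i i′ gi≡gi′ with i ≟F i′
    ... | yes i≡i′ = i≡i′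
    ... | no i≢i′ with trans (Eq.sym (irrefl G (g i))) (trans (cong (adj G (g i)) gi≡gi′) (adjacent i i′ i≢i′))
    ...   | ()

  SparseSet : ℕ → VSet n → Set
  SparseSet M S = ∀ v → S v ≡ true → degIn G S v * M ≤ count S

  -- Either `X` is sparse, or some `v` has more than |X| / M neighbours in `X`. These contain no
  -- clique with one vertex fewer, since `v` would extend it, so each recursive call lowers the
  -- clique size at the cost of a factor `M`.
  sparse-subset : ∀ M → 1 ≤ M → ∀ j X → ¬ Clique j X →
    Σ (VSet n) λ S → S ⊆ X × SparseSet M S × count X ≤ M ^ j * count S
  sparse-subset M 1≤M zero X ¬clique = ⊥-elim (¬clique tt)
  sparse-subset M 1≤M (suc j) X ¬clique
    with any? (λ v → (X v ≟ᵇ true) ×-dec (count X <? degIn G X v * M))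
  ... | no none = X , (λ _ → id)
      , (λ v Xv → ≮⇒≥ λ high → none (v , Xv , high))
      , m≤n*m (count X) (M ^ suc j) {{>-nonZero (pos-^ (suc j) 1≤M)}}
  ... | yes (v , Xv , high) =
    let (S , S⊆ , sparse , large) = sparse-subset M 1≤M j (X ∩ adj G v) (λ c → ¬clique (v , Xv , c))
    in S , (λ u Su → proj₁ (∧-true {X u} (S⊆ u Su))) , sparse , (begin
      count X                          ≤⟨ <⇒≤ high ⟩
      degIn G X v * M                  ≤⟨ *-monoˡ-≤ M large ⟩
      M ^ j * count S * M              ≡⟨ eq (M ^ j) (count S) M ⟩
      M ^ suc j * count S              ∎)
    where
    open ≤-Reasoning
    eq : ∀ x y M → x * y * M ≡ M * x * y
    eq = solve-∀

  -- A vertex has at most |V| / (4m) neighbours in `D`, having no more in `V`, and at most |Y| ≤ |V|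
  -- / (4m) in `Y`. The sum |V| / (2m) is at most |D| / m because `D` is at least half of `V`.
  sparse-absorb : ∀ m (V D Y : VSet n) → D ⊆ V → count V ≤ 2 * count D → 4 * m * count Y ≤ count V →
    (∀ v → (D ∪ Y) v ≡ true → degIn G V v * (4 * m) ≤ count V) → SparseSet m (D ∪ Y)
  sparse-absorb m V D Y D⊆V |V|≤2|D| |Y| low v D∪Yv = *-cancelˡ-≤ 4 (begin
    4 * (degIn G (D ∪ Y) v * m)                  ≤⟨ *-monoʳ-≤ 4 (*-monoˡ-≤ m (count-cover _ _ _ cover)) ⟩
    4 * ((degIn G V v + count Y) * m)            ≡⟨ eq₁ (degIn G V v) (count Y) m ⟩
    degIn G V v * (4 * m) + 4 * m * count Y      ≤⟨ +-mono-≤ (low v D∪Yv) |Y| ⟩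
    count V + count V                            ≤⟨ +-mono-≤ |V|≤2|D| |V|≤2|D| ⟩
    2 * count D + 2 * count D                    ≡⟨ eq₂ (count D) ⟩
    4 * count D                                  ≤⟨ *-monoʳ-≤ 4 (count-mono D (D ∪ Y) D⊆D∪Y) ⟩
    4 * count (D ∪ Y)                            ∎)
    where
    open ≤-Reasoning
    eq₁ : ∀ x y m → 4 * ((x + y) * m) ≡ x * (4 * m) + 4 * m * y
    eq₁ = solve-∀
    eq₂ : ∀ x → 2 * x + 2 * x ≡ 4 * x
    eq₂ = solve-∀
    D⊆D∪Y : D ⊆ D ∪ Y
    D⊆D∪Y u Du rewrite Du = refl
    cover : ∀ u → ((D ∪ Y) ∩ adj G v) u ≡ true → (V ∩ adj G v) u ≡ true ⊎ Y u ≡ true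
    cover u eq with ∧-true {(D ∪ Y) u} eq
    ... | D∪Yu , Nu with ∨-true D∪Yu
    ...   | inj₁ Du = inj₁ (∧-intro (D⊆V u Du) Nu)
    ...   | inj₂ Yu = inj₂ Yu

  -- Parking vertices at sparse sets

  fits : ℕ → VSet n → VSet n
  fits M V u = degIn G V u * M ≤ᵇ count V

  misfit : ∀ {k} → ℕ → Vec (VSet n) k → VSet n
  misfit M [] u = true
  misfit M (V ∷ Vs) u = not (fits M V u) ∧ misfit M Vs u

  fits⇒≤ : ∀ M V u → fits M V u ≡ true → degIn G V u * M ≤ count V
  fits⇒≤ M V u eq = ≤ᵇ⇒≤ _ _ (subst T (Eq.sym eq) tt)

  ¬fits⇒≥ : ∀ M V u → not (fits M V u) ≡ true → count V ≤ degIn G V u * M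
  ¬fits⇒≥ M V u eq with fits M V u in fit
  ... | false = <⇒≤ (≰⇒> λ le → subst T fit (≤⇒≤ᵇ le))

  -- `V` decides who fits, `D` is the part of it that stays behind as a set of the partition, and
  -- `ρ` bounds the number of vertices to be taken in.
  Shelter : ℕ → ℕ → VSet n → VSet n → Set
  Shelter m ρ V D = SparseSet (4 * m) V × D ⊆ V × count V ≤ 2 * count D × 4 * m * ρ ≤ count V

  -- Each vertex of `R` joins the first set that it fits, and the others are passed on. The sets
  -- stay sparse by `sparse-absorb`, since all of `R` has at most `ρ` vertices.
  park : ∀ {k} m ρ {Vs Ds : Vec (VSet n) k} (R : VSet n) → Pointwise (Shelter m ρ) Vs Ds → count R ≤ ρ →
    (∀ u → mult (toList Vs) u + ind (R u) ≤ 1) →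
    Σ (List (VSet n)) λ Ss → length Ss ≡ k × All (SparseSet m) Ss ×
      (∀ u → mult Ss u ≡ mult (toList Ds) u + ind (R u ∧ not (misfit (4 * m) Vs u)))
  park m ρ R [] |R|≤ρ disjoint = [] , refl , [] , λ u → Eq.sym (cong ind (∧-zeroʳ (R u)))
  park m ρ {V ∷ Vs} {D ∷ Ds} R ((sparse , D⊆V , |V|≤2|D| , ρ≤) ∷ shelters) |R|≤ρ disjoint =
    let R₁ = R ∖ fits (4 * m) V
        Y = R ∩ fits (4 * m) V
        (Ss , len , sparses , covers) = park m ρ R₁ shelters
          (≤-trans (count-mono R₁ R (∖-⊆ R (fits (4 * m) V))) |R|≤ρ)
          (λ u → ≤-trans (+-mono-≤ (m≤n+m _ (ind (V u))) (ind-mono (∖-⊆ R (fits (4 * m) V) u))) (disjoint u))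
    in D ∪ Y ∷ Ss , cong suc len
     , sparse-absorb m V D Y D⊆V |V|≤2|D|
         (≤-trans (*-monoʳ-≤ (4 * m) (≤-trans (count-mono Y R (∩-⊆ˡ R (fits (4 * m) V))) |R|≤ρ)) ρ≤)
         (λ v D∪Yv → low v (∨-true D∪Yv))
       ∷ sparses
     , λ u → trans (cong (ind ((D ∪ Y) u) +_) (covers u))
                   (regroup (D u) (R u) (fits (4 * m) V u) (misfit (4 * m) Vs u) _ (apart u))
    where
    low : ∀ v → D v ≡ true ⊎ (R ∩ fits (4 * m) V) v ≡ true → degIn G V v * (4 * m) ≤ count V
    low v (inj₁ Dv) = sparse v (D⊆V v Dv)
    low v (inj₂ Yv) = fits⇒≤ (4 * m) V v (proj₂ (∧-true {R v} Yv))
    apart : ∀ u → D u ≡ true → R u ≡ true → ⊥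
    apart u Du Ru = <⇒≱ {1} {2} ≤-refl (≤-trans
      (+-mono-≤ (≤-trans (≤-reflexive (Eq.sym (cong ind (D⊆V u Du)))) (m≤m+n _ _)) (≤-reflexive (Eq.sym (cong ind Ru))))
      (disjoint u))
    regroup : ∀ d r f μ x → (d ≡ true → r ≡ true → ⊥) →
      ind (d ∨ (r ∧ f)) + (x + ind ((r ∧ not f) ∧ not μ)) ≡ ind d + x + ind (r ∧ not (not f ∧ μ))
    regroup true true _ _ _ ¬both = ⊥-elim (¬both refl refl)
    regroup true false _ _ _ _ = refl
    regroup false false _ _ _ _ = refl
    regroup false true true _ x _ = eq x
      where
      eq : ∀ x → 1 + (x + 0) ≡ x + 1
      eq = solve-∀
    regroup false true false _ _ _ = refl

  Shrunk : ℕ → ℕ → VSet n → VSet n → Set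
  Shrunk M q V H = H ⊆ V × SparseSet M H × 2 * count H ≤ count V × count V ≤ q * count H

  Rich : ∀ {k} → ℕ → ℕ → Vec (VSet n) k → Set
  Rich M c Vs = ∀ x → misfit M Vs x ≡ true → vol Vs ≤ cliques (adj G x) Vs * c

-- The exponent h = 2 r w required by dense-subbox, where w bounds the factor by which the volume
-- drops when a box is cut down to the neighbourhood of a misfit.
slack : ℕ → ℕ → ℕ → ℕ
slack M b r = 2 * (r * (3 * suc b * M) ^ r)

-- Refining a box, and peeling off sparse sets

module _ {n : ℕ} (G : Graph n) (M b r : ℕ) (1≤M : 1 ≤ M)
  (large-sparse : (X : VSet n) → Σ (VSet n) λ S → S ⊆ X × SparseSet G M S × count X ≤ suc b * count S) where

  private
    a e w h g : ℕ
    a = suc b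
    e = 3 * a * M
    w = e ^ r
    h = slack M b r
    g = suc h

  -- Halving first ensures that at least half of `X` survives the removal of the new set and can
  -- shelter parked vertices. Halving costs a factor 3, the sparse subset a factor `a`.
  shrink : (X : VSet n) → 2 ≤ count X → Σ (VSet n) (Shrunk G M (3 * a) X)
  shrink X 2≤|X| =
    let (A , A⊆X , 2|A|≤|X| , |X|≤3|A|) = half-subset X 2≤|X|
        (S , S⊆A , sparse , |A|≤a|S|) = large-sparse A
    in S , (λ u → A⊆X u ∘ S⊆A u) , sparse
     , ≤-trans (*-monoʳ-≤ 2 (count-mono S A S⊆A)) 2|A|≤|X|
     , ≤-trans |X|≤3|A| (≤-trans (*-monoʳ-≤ 3 |A|≤a|S|) (≤-reflexive (Eq.sym (*-assoc 3 a (count S)))))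

  shrink-all : ∀ {k} {Vs : Vec (VSet n) k} → Allᵥ (λ V → 2 ≤ count V) Vs →
    Σ (Vec (VSet n) k) (Pointwise (Shrunk G M (3 * a)) Vs)
  shrink-all []ᵥ = [] , []
  shrink-all (2≤ ∷ᵥ 2≤s) =
    let (H , shrunk) = shrink _ 2≤
        (Hs , shrunks) = shrink-all 2≤s
    in H ∷ Hs , shrunk ∷ shrunks

  shrunk-⊑ : ∀ {k} q {Vs Hs : Vec (VSet n) k} → Pointwise (Shrunk G M q) Vs Hs → Hs ⊑ Vs
  shrunk-⊑ q [] = []
  shrunk-⊑ q ((H⊆V , _) ∷ shrunks) = H⊆V ∷ shrunk-⊑ q shrunks

  -- A misfit has at least |H| / M neighbours in every `H`, and |H| ≥ |V| / (3a), so each coordinate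
  -- loses at most the factor `e = 3 * a * M`.
  misfit-box : ∀ {k} {Vs Hs : Vec (VSet n) k} → Pointwise (Shrunk G M (3 * a)) Vs Hs →
    ∀ x → misfit G M Hs x ≡ true → vol Vs ≤ e ^ k * vol (Vs ⊓ map (_∩ adj G x) Hs)
  misfit-box [] x _ = ≤-refl
  misfit-box {suc k} {V ∷ Vs} {H ∷ Hs} ((H⊆V , _ , _ , |V|≤) ∷ shrunks) x mis = begin
    count V * vol Vs                           ≤⟨ *-mono-≤ |V|≤e (misfit-box shrunks x (proj₂ misses)) ⟩
    e * count V′ * (e ^ k * vol Vs′)           ≡⟨ eq e (count V′) (e ^ k) (vol Vs′) ⟩
    e ^ suc k * (count V′ * vol Vs′)           ∎
    where
    open ≤-Reasoning
    V′ = V ∩ H ∩ adj G x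
    Vs′ = Vs ⊓ map (_∩ adj G x) Hs
    misses : not (fits G M H x) ≡ true × misfit G M Hs x ≡ true
    misses = ∧-true mis
    eq : ∀ e x E y → e * x * (E * y) ≡ e * E * (x * y)
    eq = solve-∀
    eq′ : ∀ a x M → 3 * a * (x * M) ≡ 3 * a * M * x
    eq′ = solve-∀
    |V|≤e : count V ≤ e * count V′
    |V|≤e = begin
      count V                          ≤⟨ |V|≤ ⟩
      3 * a * count H                  ≤⟨ *-monoʳ-≤ (3 * a) (¬fits⇒≥ G M H x (proj₁ misses)) ⟩
      3 * a * (degIn G H x * M)        ≤⟨ *-monoʳ-≤ (3 * a) (*-monoˡ-≤ M (count-mono (H ∩ adj G x) V′
                                            (λ u eq → ∧-intro (H⊆V u (proj₁ (∧-true {H u} eq))) eq))) ⟩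
      3 * a * (count V′ * M)           ≡⟨ eq′ a (count V′) M ⟩
      e * count V′                     ∎

  restricted-cliques : ∀ {k} (Vs Hs : Vec (VSet n) k) x →
    cliques G (const true) (Vs ⊓ map (_∩ adj G x) Hs) ≤ cliques G (adj G x) Hs
  restricted-cliques Vs Hs x = cliques-mono G (pointwise Vs Hs)
    where
    pointwise : ∀ {k} (Vs Hs : Vec (VSet n) k) →
      Pointwise (λ A B → ∀ u → A u ≡ true → true ≡ true → B u ≡ true × adj G x u ≡ true)
                (Vs ⊓ map (_∩ adj G x) Hs) Hs
    pointwise [] [] = []
    pointwise (V ∷ Vs) (H ∷ Hs) =
      (λ u eq _ → ∧-true {H u} (proj₂ (∧-true {V u} eq))) ∷ pointwise Vs Hs

  -- The loop never decreases cliques(B) ^ g / vol(B) ^ h, so the density stays at least 1 / d and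
  -- vol B stays at least vol B₀ / d ^ g, however many times it is run.
  module _ {k : ℕ} (k≤r : k ≤ r) (d : ℕ) (B₀ : Vec (VSet n) k)
    (1≤vol₀ : 1 ≤ vol B₀) (big : Allᵥ (λ V → 2 * d ^ g ≤ count V) B₀)
    (dense : vol B₀ ≤ cliques G (const true) B₀ * d) where

    private
      N : Vec (VSet n) k → ℕ
      N = cliques G (const true)

      1≤d : 1 ≤ d
      1≤d = factorʳ-pos (N B₀) (≤-trans 1≤vol₀ dense)

    -- Division-free form of N(B)^g / vol(B)^h ≥ vol(B₀) / d^g, whose right side is a lower bound
    -- for the potential of `B₀`.
    Potential : Vec (VSet n) k → Set
    Potential B = vol B ^ h * vol B₀ ≤ N B ^ g * d ^ g

    potential-start : Potential B₀
    potential-start = begin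
      vol B₀ ^ h * vol B₀          ≡⟨ *-comm (vol B₀ ^ h) (vol B₀) ⟩
      vol B₀ ^ g                   ≤⟨ ^-monoˡ-≤ g dense ⟩
      (N B₀ * d) ^ g               ≡⟨ ^-distribʳ-* g (N B₀) d ⟩
      N B₀ ^ g * d ^ g             ∎
      where open ≤-Reasoning

    -- As `N B ≤ vol B` and `g = suc h`, the potential of `B` is at most `vol B`.
    potential-size : ∀ B → 1 ≤ vol B → Potential B → vol B₀ ≤ vol B * d ^ g
    potential-size B 1≤v potential = cancel-≤ (pos-^ h 1≤v) (begin
      v ^ h * vol B₀          ≤⟨ potential ⟩
      N B ^ g * d ^ g         ≤⟨ *-monoˡ-≤ (d ^ g) (^-monoˡ-≤ g (cliques≤vol G (const true) B)) ⟩
      v * v ^ h * d ^ g       ≡⟨ eq v (v ^ h) (d ^ g) ⟩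
      v ^ h * (v * d ^ g)     ∎)
      where
      open ≤-Reasoning
      v = vol B
      eq : ∀ v x y → v * x * y ≡ x * (v * y)
      eq = solve-∀

    -- Replacing `vol B₀` by the smaller `vol B` leaves an inequality between g-th powers.
    potential-density : ∀ B → B ⊑ B₀ → Potential B → vol B ≤ N B * d
    potential-density B B⊑B₀ potential = ^-cancelˡ-≤ h (begin
      vol B * vol B ^ h            ≤⟨ *-monoˡ-≤ (vol B ^ h) (vol-mono B⊑B₀) ⟩
      vol B₀ * vol B ^ h           ≡⟨ *-comm (vol B₀) (vol B ^ h) ⟩
      vol B ^ h * vol B₀           ≤⟨ potential ⟩
      N B ^ g * d ^ g              ≡⟨ ^-distribʳ-* g (N B) d ⟨
      (N B * d) ^ g                ∎)
      where open ≤-Reasoning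

    potential-next : ∀ B B′ → 1 ≤ vol B → Potential B → vol B′ ^ h * N B ^ g ≤ vol B ^ h * N B′ ^ g → Potential B′
    potential-next B B′ 1≤v potential increase = cancel-≤ (pos-^ h 1≤v) (begin
      v ^ h * (v′ ^ h * vol B₀)             ≡⟨ eq₁ (v ^ h) (v′ ^ h) (vol B₀) ⟩
      v′ ^ h * (v ^ h * vol B₀)             ≤⟨ *-monoʳ-≤ (v′ ^ h) potential ⟩
      v′ ^ h * (N B ^ g * d ^ g)            ≡⟨ *-assoc (v′ ^ h) (N B ^ g) (d ^ g) ⟨
      v′ ^ h * N B ^ g * d ^ g              ≤⟨ *-monoˡ-≤ (d ^ g) increase ⟩
      v ^ h * N B′ ^ g * d ^ g              ≡⟨ *-assoc (v ^ h) (N B′ ^ g) (d ^ g) ⟩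
      v ^ h * (N B′ ^ g * d ^ g)            ∎)
      where
      open ≤-Reasoning
      v = vol B
      v′ = vol B′
      eq₁ : ∀ x y z → x * (y * z) ≡ y * (x * z)
      eq₁ = solve-∀

    still-large : ∀ {k} {B B₀ : Vec (VSet n) k} → Allᵥ (λ V → 2 * d ^ g ≤ count V) B₀ →
      Pointwise (λ A V → count V ≤ count A * d ^ g) B B₀ → Allᵥ (λ V → 2 ≤ count V) B
    still-large []ᵥ [] = []ᵥ
    still-large {B = A ∷ _} {V ∷ _} (big ∷ᵥ bigs) (bound ∷ bounds) =
      cancel-≤ (pos-^ g 1≤d) (begin
        d ^ g * 2             ≡⟨ *-comm (d ^ g) 2 ⟩
        2 * d ^ g             ≤⟨ big ⟩
        count V               ≤⟨ bound ⟩
        count A * d ^ g       ≡⟨ *-comm (count A) (d ^ g) ⟩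
        d ^ g * count A       ∎)
      ∷ᵥ still-large bigs bounds
      where open ≤-Reasoning

    combine : ∀ {k} {B B₀ Hs : Vec (VSet n) k} → B ⊑ B₀ → Pointwise (λ A V → count V ≤ count A * d ^ g) B B₀ →
      Pointwise (Shrunk G M (3 * a)) B Hs → Pointwise (Shrunk G M (3 * a * d ^ g)) B₀ Hs
    combine [] [] [] = []
    combine {B = A ∷ _} {V ∷ _} {H ∷ _} (A⊆V ∷ subs) (bound ∷ bounds) ((H⊆A , sparse , half , |A|≤) ∷ shrunks) =
      ( (λ u → A⊆V u ∘ H⊆A u)
      , sparse
      , ≤-trans half (count-mono A V A⊆V)
      , (begin
        count V                          ≤⟨ bound ⟩
        count A * d ^ g                  ≤⟨ *-monoˡ-≤ (d ^ g) |A|≤ ⟩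
        3 * a * count H * d ^ g          ≡⟨ eq (3 * a) (count H) (d ^ g) ⟩
        3 * a * d ^ g * count H          ∎))
      ∷ combine subs bounds shrunks
      where
      open ≤-Reasoning
      eq : ∀ x y z → x * y * z ≡ x * z * y
      eq = solve-∀

    Refinement : Set
    Refinement = Σ (Vec (VSet n) k) λ Hs → Pointwise (Shrunk G M (3 * a * d ^ g)) B₀ Hs × Rich G M (g * d) Hs

    -- If a misfit `x` of the shrunk box `Hs` sees too few cliques, `B` is cut down to the
    -- neighbours of `x` in `Hs`. Were no discarded box to gain, `dense-subbox` would make the cut
    -- box dense, against the choice of `x`. So some discarded box gains and replaces `B`, with
    -- smaller volume.
    refine-loop : ∀ B → Acc _<_ (vol B) → B ⊑ B₀ → 1 ≤ vol B → Potential B → Refinement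
    refine-loop B (acc smaller) B⊑B₀ 1≤v potential
      with coordinate-bound B⊑B₀ 1≤vol₀ (potential-size B 1≤v potential)
    ... | bounds with shrink-all (still-large big bounds)
    ... | Hs , shrunks
      with any? (λ x → (misfit G M Hs x ≟ᵇ true) ×-dec (cliques G (adj G x) Hs * (g * d) <? vol Hs))
    ...   | no none = Hs , combine B⊑B₀ bounds shrunks , λ x mis → ≮⇒≥ λ poor → none (x , mis , poor)
    ...   | yes (x , mis , poor)
      -- With these coefficients the test of `sweep` is `gain` in `potential-step`, and the other
      -- outcome is `total` in `dense-subbox`.
      with sweep N vol (cliques-additive G k (const true)) (vol-additive k) (g * vol B) (N B * h) (N B * vol B)
             B (map (_∩ adj G x) Hs)
    ...     | inj₁ (B′ , B′⊑B , N′≤N , gain) =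
      let (v′<v , 1≤N′ , increase) = potential-step h 1≤v N′≤N gain
      in refine-loop B′ (smaller v′<v) (⊑-trans B′⊑B B⊑B₀) (≤-trans 1≤N′ (cliques≤vol G (const true) B′))
           (potential-next B B′ 1≤v potential increase)
    ...     | inj₂ total = ⊥-elim (<⇒≱ poor (begin
      vol Hs                                                            ≤⟨ vol-mono (shrunk-⊑ (3 * a) shrunks) ⟩
      vol B                                                             ≤⟨ dense-subbox {r} {k} {w} 1≤v k≤r
                                                                             (≤-trans (misfit-box shrunks x mis) (*-monoˡ-≤ _ e^k≤w))
                                                                             (potential-density B B⊑B₀ potential) total ⟩
      N (B ⊓ map (_∩ adj G x) Hs) * (g * d)                             ≤⟨ *-monoˡ-≤ (g * d) (restricted-cliques B Hs x) ⟩
      cliques G (adj G x) Hs * (g * d)                                  ∎))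
      where
      open ≤-Reasoning
      e^k≤w : e ^ k ≤ w
      e^k≤w = ^-monoʳ-≤ e {{>-nonZero (*-mono-≤ {1} {3 * a} {1} {M} (s≤s z≤n) 1≤M)}} k≤r

    refine : Refinement
    refine = refine-loop B₀ (<-wellFounded _) (⊑-refl B₀) 1≤vol₀ potential-start

  record Peeled (s : ℕ) (X : VSet n) : Set where
    field
      sets     : List (VSet n)
      leftover : VSet n
      number   : length sets ≡ s
      sparse   : All (SparseSet G M) sets
      covers   : ∀ u → ind (X u) ≡ mult sets u + ind (leftover u)
      small    : count leftover * a ^ s ≤ b ^ s * count X

  peel : ∀ s X → Peeled s X
  peel zero X = record
    { sets = [] ; leftover = X ; number = refl ; sparse = [] ; covers = λ u → refl
    ; small = ≤-reflexive (*-comm (count X) 1) }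
  peel (suc s) X = record
    { sets = S ∷ sets ; leftover = leftover ; number = cong suc number ; sparse = S-sparse ∷ sparse
    ; covers = λ u → trans (Eq.sym (ind-⊆ (S⊆X u)))
        (trans (+-comm _ (ind (S u))) (trans (cong (ind (S u) +_) (covers u)) (Eq.sym (+-assoc (ind (S u)) _ _))))
    ; small = begin
        count leftover * (a * a ^ s)          ≡⟨ eq₁ (count leftover) a (a ^ s) ⟩
        count leftover * a ^ s * a            ≤⟨ *-monoˡ-≤ a small ⟩
        b ^ s * count (X ∖ S) * a             ≡⟨ *-assoc (b ^ s) _ a ⟩
        b ^ s * (count (X ∖ S) * a)           ≤⟨ *-monoʳ-≤ (b ^ s) shrinks ⟩
        b ^ s * (b * count X)                 ≡⟨ eq₂ (b ^ s) b (count X) ⟩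
        b * b ^ s * count X                   ∎
    }
    where
    open ≤-Reasoning
    chosen = large-sparse X
    S = proj₁ chosen
    S⊆X = proj₁ (proj₂ chosen)
    S-sparse = proj₁ (proj₂ (proj₂ chosen))
    large = proj₂ (proj₂ (proj₂ chosen))
    open Peeled (peel s (X ∖ S))
    eq₁ : ∀ x a y → x * (a * y) ≡ x * y * a
    eq₁ = solve-∀
    eq₂ : ∀ x b y → x * (b * y) ≡ b * x * y
    eq₂ = solve-∀
    eq₃ : ∀ b x y → y * suc b + suc b * x ≡ (x + y) + b * (x + y)
    eq₃ = solve-∀
    |X| : count X ≡ count S + count (X ∖ S)
    |X| = count-∖ X S S⊆X
    shrinks : count (X ∖ S) * a ≤ b * count X
    shrinks = +-cancelʳ-≤ (count X) _ _ (begin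
      count (X ∖ S) * a + count X                  ≤⟨ +-monoʳ-≤ _ large ⟩
      count (X ∖ S) * a + a * count S              ≡⟨ eq₃ b (count S) (count (X ∖ S)) ⟩
      (count S + count (X ∖ S)) + b * (count S + count (X ∖ S))
                                                   ≡⟨ cong (λ x → x + b * x) |X| ⟨
      count X + b * count X                        ≡⟨ +-comm (count X) _ ⟩
      b * count X + count X                        ∎)

  -- A round keeps at most the fraction `b / a`, and by `geometric-decay` every `a` rounds halve the
  -- remainder.
  peel-small : ∀ l X (P : Peeled (a * l) X) → count (Peeled.leftover P) * 2 ^ l ≤ count X
  peel-small l X P = cancel-≤ (pos-^ {a} (a * l) (s≤s z≤n)) (begin
    a ^ (a * l) * (count leftover * 2 ^ l)          ≡⟨ eq (a ^ (a * l)) (count leftover) (2 ^ l) ⟩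
    count leftover * a ^ (a * l) * 2 ^ l            ≤⟨ *-monoˡ-≤ (2 ^ l) small ⟩
    b ^ (a * l) * count X * 2 ^ l                   ≡⟨ eq′ (b ^ (a * l)) (count X) (2 ^ l) ⟩
    b ^ (a * l) * 2 ^ l * count X                   ≤⟨ *-monoˡ-≤ (count X) (geometric-decay b l) ⟩
    a ^ (a * l) * count X                           ∎)
    where
    open ≤-Reasoning
    open Peeled P
    eq : ∀ x y z → x * (y * z) ≡ y * x * z
    eq = solve-∀
    eq′ : ∀ x y z → x * y * z ≡ x * z * y
    eq′ = solve-∀

-- Induction on the number of levels

-- Peeling shrinks the leftover by 2^l. The left side collects the competing factors: `4 * m` for
-- the room a host needs, `suc b` for choosing a sparse set, `3 * suc b` for shrinking, and
-- `(g ^ r) ^ g` for refining a box of density at least 1 / g^r.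
DeepEnough : ℕ → ℕ → ℕ → ℕ → Set
DeepEnough m b r l = let g = suc (slack (4 * m) b r) in 4 * m * (suc b * (3 * suc b * (g ^ r) ^ g)) ≤ 2 ^ l

module _ {n : ℕ} (G : Graph n) (m b r l : ℕ) (1≤m : 1 ≤ m)
  (large-sparse : (X : VSet n) → Σ (VSet n) λ S → S ⊆ X × SparseSet G (4 * m) S × count X ≤ suc b * count S)
  (¬clique : ¬ Clique G (suc r) (const true))
  (deep : DeepEnough m b r l) where

  private
    M a g D s step : ℕ
    M = 4 * m
    a = suc b
    g = suc (slack M b r)
    D = (g ^ r) ^ g
    s = a * l
    -- Sets produced on one level: at most `r` old hosts with their parked vertices, one set from
    -- the new host, and `s` peeled sets.
    step = suc (r + s)

    1≤M : 1 ≤ M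
    1≤M = *-mono-≤ {1} {4} (s≤s z≤n) 1≤m

    1≤g^ : ∀ i → 1 ≤ g ^ i
    1≤g^ i = pos-^ {g} i (s≤s z≤n)

  sparse-large-part : ∀ {V D} → SparseSet G M V → D ⊆ V → count V ≤ 2 * count D → SparseSet G m D
  sparse-large-part {V} {D} sparse D⊆V |V|≤2|D| v Dv = *-cancelˡ-≤ 4 (begin
    4 * (degIn G D v * m)          ≡⟨ eq (degIn G D v) m ⟩
    degIn G D v * M                ≤⟨ *-monoˡ-≤ M (count-mono (D ∩ adj G v) (V ∩ adj G v) D∩N⊆V∩N) ⟩
    degIn G V v * M                ≤⟨ sparse v (D⊆V v Dv) ⟩
    count V                        ≤⟨ |V|≤2|D| ⟩
    2 * count D                    ≤⟨ *-monoˡ-≤ (count D) {2} {4} (s≤s (s≤s z≤n)) ⟩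
    4 * count D                    ∎)
    where
    open ≤-Reasoning
    eq : ∀ x m → 4 * (x * m) ≡ x * (4 * m)
    eq = solve-∀
    D∩N⊆V∩N : D ∩ adj G v ⊆ V ∩ adj G v
    D∩N⊆V∩N u eq with ∧-true {D u} eq
    ... | Du , Nu = ∧-intro (D⊆V u Du) Nu

  remove-half : ∀ (V H : VSet n) → H ⊆ V → 2 * count H ≤ count V → count V ≤ 2 * count (V ∖ H)
  remove-half V H H⊆V 2|H|≤|V| = +-cancelˡ-≤ (count V) _ _ (begin
    count V + count V                              ≡⟨ cong₂ _+_ |V| |V| ⟩
    (count H + x) + (count H + x)                  ≡⟨ eq (count H) x ⟩
    2 * count H + 2 * x                            ≤⟨ +-monoˡ-≤ (2 * x) 2|H|≤|V| ⟩
    count V + 2 * x                                ∎)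
    where
    open ≤-Reasoning
    x = count (V ∖ H)
    |V| : count V ≡ count H + x
    |V| = count-∖ V H H⊆V
    eq : ∀ h x → (h + x) + (h + x) ≡ 2 * h + 2 * x
    eq = solve-∀

  -- The hosts are redistributed together with `R`, so that the part of a host handed to the next
  -- level is accounted for there.
  Solution : ∀ {k} → ℕ → Vec (VSet n) k → VSet n → Set
  Solution κ Vs R = Σ (List (VSet n)) λ Ss → length Ss ≤ κ × All (SparseSet G m) Ss ×
    (∀ u → mult Ss u ≡ mult (toList Vs) u + ind (R u))

  Host : ℕ → VSet n → Set
  Host ρ V = SparseSet G M V × M * ρ ≤ count V

  keep-hosts : ∀ {k ρ} {Vs : Vec (VSet n) k} → Allᵥ (Host ρ) Vs → Pointwise (Shelter G m ρ) Vs Vs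
  keep-hosts []ᵥ = []
  keep-hosts {Vs = V ∷ _} ((sparse , ρ≤) ∷ᵥ hosts) = (sparse , (λ _ → id) , m≤m+n (count V) _ , ρ≤) ∷ keep-hosts hosts

  split-hosts : ∀ {k ρ} q {Vs Hs : Vec (VSet n) k} → Allᵥ (Host ρ) Vs →
    Pointwise (Shrunk G M q) Vs Hs → Pointwise (Shelter G m ρ) Vs (zipWith _∖_ Vs Hs)
  split-hosts q []ᵥ [] = []
  split-hosts q {V ∷ _} {H ∷ _} ((sparse , ρ≤) ∷ᵥ hosts) ((H⊆V , _ , half , _) ∷ shrunks) =
    (sparse , ∖-⊆ V H , remove-half V H H⊆V half , ρ≤) ∷ split-hosts q hosts shrunks

  -- Each `V` has at least ρ / a vertices and `H` at least |V| / (3aD), while `ρ′` is at most ρ /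
  -- 2^l. By `deep` this leaves the factor `M` that a host needs.
  new-hosts : ∀ {k c ρ ρ′} {Vs Hs : Vec (VSet n) k} → c ≤ g ^ r → ρ′ * 2 ^ l ≤ ρ →
    Allᵥ (λ V → ρ ≤ a * count V) Vs → Pointwise (Shrunk G M (3 * a * c ^ g)) Vs Hs →
    Allᵥ (Host ρ′) Hs
  new-hosts c≤ ρ′≤ []ᵥ [] = []ᵥ
  new-hosts {c = c} {ρ} {ρ′} {V ∷ _} {H ∷ _} c≤ ρ′≤ (ρ≤ ∷ᵥ ρ≤s) ((_ , sparse , _ , |V|≤) ∷ shrunks) =
    (sparse , cancel-≤ {c = a * (3 * a * D)} (*-mono-≤ {1} {a} (s≤s z≤n) (*-mono-≤ {1} {3 * a} (s≤s z≤n) (pos-^ g (1≤g^ r)))) (begin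
      a * (3 * a * D) * (M * ρ′)              ≡⟨ eq₁ (a * (3 * a * D)) M ρ′ ⟩
      ρ′ * (M * (a * (3 * a * D)))            ≤⟨ *-monoʳ-≤ ρ′ deep ⟩
      ρ′ * 2 ^ l                              ≤⟨ ρ′≤ ⟩
      ρ                                       ≤⟨ ρ≤ ⟩
      a * count V                             ≤⟨ *-monoʳ-≤ a |V|≤ ⟩
      a * (3 * a * c ^ g * count H)           ≤⟨ *-monoʳ-≤ a (*-monoˡ-≤ (count H) (*-monoʳ-≤ (3 * a) (^-monoˡ-≤ g c≤))) ⟩
      a * (3 * a * D * count H)               ≡⟨ *-assoc a (3 * a * D) (count H) ⟨
      a * (3 * a * D) * count H               ∎))
    ∷ᵥ new-hosts c≤ ρ′≤ ρ≤s shrunks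
    where
    open ≤-Reasoning
    eq₁ : ∀ x M y → x * (M * y) ≡ y * (M * x)
    eq₁ = solve-∀

  -- Supplies the size hypothesis of `refine`. The bound `2 ^ l ≤ ρ` is available once a vertex is
  -- left over after peeling; an empty leftover is treated by `exhausted`.
  hosts-big : ∀ {k c ρ} {Vs : Vec (VSet n) k} → c ≤ g ^ r → 2 ^ l ≤ ρ →
    Allᵥ (λ V → ρ ≤ a * count V) Vs → Allᵥ (λ V → 2 * c ^ g ≤ count V) Vs
  hosts-big c≤ l≤ []ᵥ = []ᵥ
  hosts-big {c = c} {ρ} {V ∷ _} c≤ l≤ (ρ≤ ∷ᵥ ρ≤s) = cancel-≤ {c = a} (s≤s z≤n) (begin
      a * (2 * c ^ g)                 ≤⟨ *-monoʳ-≤ a (*-mono-≤ {2} {3 * a} (s≤s (≤-trans (s≤s z≤n) (m≤n+m _ b))) (^-monoˡ-≤ g c≤)) ⟩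
      a * (3 * a * D)                 ≤⟨ m≤n*m _ M {{>-nonZero 1≤M}} ⟩
      M * (a * (3 * a * D))           ≤⟨ deep ⟩
      2 ^ l                           ≤⟨ l≤ ⟩
      ρ                               ≤⟨ ρ≤ ⟩
      a * count V                     ∎)
    ∷ᵥ hosts-big c≤ l≤ ρ≤s
    where open ≤-Reasoning

  all-counts-pos : ∀ {k ρ x} {Vs : Vec (VSet n) k} → 1 ≤ ρ → Allᵥ (λ V → ρ ≤ x * count V) Vs → Allᵥ (λ V → 1 ≤ count V) Vs
  all-counts-pos 1≤ρ []ᵥ = []ᵥ
  all-counts-pos {x = x} 1≤ρ (ρ≤ ∷ᵥ ρ≤s) = factorʳ-pos x (≤-trans 1≤ρ ρ≤) ∷ᵥ all-counts-pos {x = x} 1≤ρ ρ≤s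

  host-counts : ∀ {k ρ ρ′} {Vs : Vec (VSet n) k} → ρ′ ≤ ρ → Allᵥ (Host ρ) Vs → Allᵥ (λ V → ρ′ ≤ a * count V) Vs
  host-counts ρ′≤ρ []ᵥ = []ᵥ
  host-counts {ρ = ρ} {ρ′} {V ∷ _} ρ′≤ρ ((_ , ρ≤) ∷ᵥ hosts) = (begin
      ρ′                  ≤⟨ ρ′≤ρ ⟩
      ρ                   ≤⟨ m≤n*m ρ M {{>-nonZero 1≤M}} ⟩
      M * ρ               ≤⟨ ρ≤ ⟩
      count V             ≤⟨ m≤n*m (count V) a ⟩
      a * count V         ∎)
    ∷ᵥ host-counts ρ′≤ρ hosts
    where open ≤-Reasoning

  module _ {k : ℕ} (c : ℕ) (k≤r : k ≤ r) (Vs : Vec (VSet n) k) (R : VSet n) (hosts : Allᵥ (Host (count R)) Vs)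
    (disjoint : ∀ u → mult (toList Vs) u + ind (R u) ≤ 1) (rich : Rich G M c Vs) where

    private
      R′ : VSet n
      R′ = R ∩ misfit G M Vs

      parkable : Fin n → Bool
      parkable u = R u ∧ not (misfit G M Vs u)

      ind-R : ∀ u → ind (R u) ≡ ind (R′ u) + ind (parkable u)
      ind-R u = ind-split (R u) (misfit G M Vs u)

      parked : ∀ {Ds} → Pointwise (Shelter G m (count R)) Vs Ds → Σ (List (VSet n)) λ Ss →
        length Ss ≡ k × All (SparseSet G m) Ss × (∀ u → mult Ss u ≡ mult (toList Ds) u + ind (parkable u))
      parked shelters = park G m (count R) R shelters ≤-refl disjoint

    no-misfits : (∀ u → R′ u ≡ false) → Solution k Vs R
    no-misfits empty =
      let (Ss , len , sparse , covers) = parked (keep-hosts hosts)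
      in Ss , ≤-reflexive len , sparse , λ u → trans (covers u)
           (cong (mult (toList Vs) u +_) (Eq.sym (trans (ind-R u) (cong (λ b → ind b + ind (parkable u)) (empty u)))))

    -- By richness a misfit `x` would see a K_r in its neighbourhood, completing a K_{r+1}. The
    -- volume is positive because every host is at least as large as `R`, which contains `x`.
    final-level : k ≡ r → Solution k Vs R
    final-level refl = no-misfits λ x → not-true λ R′x →
      let (Rx , mis) = ∧-true {R x} R′x
          positive = factorˡ-pos (≤-trans
            (vol-pos (all-counts-pos {x = a} (count-member R x Rx) (host-counts ≤-refl hosts))) (rich x mis))
      in ¬clique (x , refl , cliques-clique G (adj G x) Vs positive)

    module _ {κ} (c≤g^r : c ≤ g ^ r) (k<r : k < r)
      (next : ∀ (Hs : Vec (VSet n) (suc k)) L → Allᵥ (Host (count L)) Hs →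
        (∀ u → mult (toList Hs) u + ind (L u) ≤ 1) → Rich G M (g * c) Hs → Solution κ Hs L) where

      private
        -- `S₁` becomes the new coordinate: since it consists of misfits of `Vs`, the box `S₁ ∷ Vs`
        -- has density at least 1 / c.
        chosen = large-sparse R′
        S₁ = proj₁ chosen
        S₁⊆R′ = proj₁ (proj₂ chosen)
        S₁-sparse = proj₁ (proj₂ (proj₂ chosen))
        |R′|≤a|S₁| = proj₂ (proj₂ (proj₂ chosen))
        peeled = peel G M b r 1≤M large-sparse s (R′ ∖ S₁)
        open Peeled peeled using (sets; leftover; number; sparse; covers)

        leftover-small : count leftover * 2 ^ l ≤ count R′
        leftover-small = ≤-trans (peel-small G M b r 1≤M large-sparse l (R′ ∖ S₁) peeled)
          (count-mono (R′ ∖ S₁) R′ (∖-⊆ R′ S₁))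

        ind-R′ : ∀ u → ind (R′ u) ≡ ind (S₁ u) + (mult sets u + ind (leftover u))
        ind-R′ u = trans (Eq.sym (ind-⊆ (S₁⊆R′ u))) (trans (+-comm _ (ind (S₁ u))) (cong (ind (S₁ u) +_) (covers u)))

        sets-sparse : All (SparseSet G m) sets
        sets-sparse = All.map (λ {V} sp → sparse-large-part sp (λ _ → id) (m≤m+n (count V) _)) sparse

        length-parts : ∀ {Ss Ts : List (VSet n)} {D : VSet n} {κ′} → length Ss ≡ k → length Ts ≤ κ′ →
          length (Ss ++ (D ∷ sets) ++ Ts) ≤ step + κ′
        length-parts {Ss} {Ts} {D} {κ′} |Ss| |Ts| = begin
          length (Ss ++ (D ∷ sets) ++ Ts)                  ≡⟨ length-++ Ss ⟩
          length Ss + length ((D ∷ sets) ++ Ts)            ≡⟨ cong (length Ss +_) (length-++ (D ∷ sets)) ⟩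
          length Ss + (suc (length sets) + length Ts)      ≡⟨ cong₂ (λ x y → x + (suc y + length Ts)) |Ss| number ⟩
          k + (suc s + length Ts)                          ≤⟨ +-mono-≤ k≤r (+-monoʳ-≤ (suc s) |Ts|) ⟩
          r + (suc s + κ′)                                 ≡⟨ eq r s κ′ ⟩
          step + κ′                                        ∎
          where
          open ≤-Reasoning
          eq : ∀ r s κ → r + (suc s + κ) ≡ suc (r + s) + κ
          eq = solve-∀

      exhausted : (∀ u → leftover u ≡ false) → Solution step Vs R
      exhausted empty =
        let (Ss , len , Ss-sparse , Ss-covers) = parked (keep-hosts hosts)
        in Ss ++ (S₁ ∷ sets) ++ []
         , ≤-trans (length-parts {Ss} {[]} {S₁} len ≤-refl) (≤-reflexive (+-identityʳ step))
         , ++⁺ Ss-sparse (++⁺ (sparse-large-part S₁-sparse (λ _ → id) (m≤m+n (count S₁) _) ∷ sets-sparse) [])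
         , λ u → begin
             mult (Ss ++ (S₁ ∷ sets) ++ []) u
               ≡⟨ trans (mult-++ Ss _ u) (cong (mult Ss u +_) (mult-++ (S₁ ∷ sets) [] u)) ⟩
             mult Ss u + (ind (S₁ u) + mult sets u + 0)
               ≡⟨ cong₂ (λ x y → x + (ind (S₁ u) + mult sets u + y)) (Ss-covers u) (Eq.sym (cong ind (empty u))) ⟩
             mult (toList Vs) u + ind (parkable u) + (ind (S₁ u) + mult sets u + ind (leftover u))
               ≡⟨ eq (mult (toList Vs) u) (ind (parkable u)) (ind (S₁ u)) (mult sets u) (ind (leftover u)) ⟩
             mult (toList Vs) u + ((ind (S₁ u) + (mult sets u + ind (leftover u))) + ind (parkable u))
               ≡⟨ cong (λ x → mult (toList Vs) u + (x + ind (parkable u))) (ind-R′ u) ⟨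
             mult (toList Vs) u + (ind (R′ u) + ind (parkable u))
               ≡⟨ cong (mult (toList Vs) u +_) (ind-R u) ⟨
             mult (toList Vs) u + ind (R u)
               ∎
        where
        open ≡-Reasoning
        eq : ∀ x p s t y → x + p + (s + t + y) ≡ x + ((s + (t + y)) + p)
        eq = solve-∀

      module _ (x : Fin n) (Lx : leftover x ≡ true) where

        private
          2^l≤|R′| : 2 ^ l ≤ count R′
          2^l≤|R′| = ≤-trans (m≤n*m (2 ^ l) (count leftover) {{>-nonZero (count-member leftover x Lx)}}) leftover-small

          1≤|R′| : 1 ≤ count R′
          1≤|R′| = ≤-trans (m^n>0 2 l) 2^l≤|R′|

          counts : Allᵥ (λ V → count R′ ≤ a * count V) (S₁ ∷ Vs)
          counts = |R′|≤a|S₁| ∷ᵥ host-counts (count-mono R′ R (∩-⊆ˡ R (misfit G M Vs))) hosts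

          q : ℕ
          q = 3 * a * c ^ g

          refined : Σ (Vec (VSet n) (suc k)) λ Hs → Pointwise (Shrunk G M q) (S₁ ∷ Vs) Hs × Rich G M (g * c) Hs
          refined = refine G M b r 1≤M large-sparse k<r c (S₁ ∷ Vs)
            (vol-pos (all-counts-pos {x = a} 1≤|R′| counts)) (hosts-big c≤g^r 2^l≤|R′| counts)
            (vol≤cliques-cons G c S₁ Vs λ v S₁v → rich v (proj₂ (∧-true {R v} (S₁⊆R′ v S₁v))))

          still-disjoint : ∀ {Hs : Vec (VSet n) (suc k)} → Hs ⊑ (S₁ ∷ Vs) →
            ∀ u → mult (toList Hs) u + ind (leftover u) ≤ 1
          still-disjoint {Hs} Hs⊑ u = begin
            mult (toList Hs) u + ind (leftover u)
              ≤⟨ +-monoˡ-≤ _ (mult-mono Hs⊑ u) ⟩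
            ind (S₁ u) + mult (toList Vs) u + ind (leftover u)
              ≤⟨ m≤m+n _ (mult sets u + ind (parkable u)) ⟩
            ind (S₁ u) + mult (toList Vs) u + ind (leftover u) + (mult sets u + ind (parkable u))
              ≡⟨ eq (ind (S₁ u)) (mult (toList Vs) u) (ind (leftover u)) (mult sets u) (ind (parkable u)) ⟩
            mult (toList Vs) u + ((ind (S₁ u) + (mult sets u + ind (leftover u))) + ind (parkable u))
              ≡⟨ cong (λ x → mult (toList Vs) u + (x + ind (parkable u))) (ind-R′ u) ⟨
            mult (toList Vs) u + (ind (R′ u) + ind (parkable u))
              ≡⟨ cong (mult (toList Vs) u +_) (ind-R u) ⟨
            mult (toList Vs) u + ind (R u)
              ≤⟨ disjoint u ⟩
            1 ∎
            where
            open ≤-Reasoning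
            eq : ∀ s x y t p → s + x + y + (t + p) ≡ x + ((s + (t + y)) + p)
            eq = solve-∀

          -- Three sources of sets: the parts `V ∖ H` of the old hosts with the parked vertices,
          -- `S₁ ∖ H` with the peeled sets, and the solution of the next level, which redistributes
          -- `H ∷ Hs` and `leftover`.
          assemble : ∀ H (Hs : Vec (VSet n) k) → H ⊆ S₁ → 2 * count H ≤ count S₁ → Hs ⊑ Vs →
            (Σ (List (VSet n)) λ Ss → length Ss ≡ k × All (SparseSet G m) Ss ×
              (∀ u → mult Ss u ≡ mult (toList (zipWith _∖_ Vs Hs)) u + ind (parkable u))) →
            Solution κ (H ∷ Hs) leftover → Solution (step + κ) Vs R
          assemble H Hs H⊆S₁ half Hs⊑Vs (Ss , len , Ss-sparse , Ss-covers) (Ts , Ts-len , Ts-sparse , Ts-covers) =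
            Ss ++ (S₁ ∖ H ∷ sets) ++ Ts
            , length-parts {Ss} {Ts} {S₁ ∖ H} len Ts-len
            , ++⁺ Ss-sparse (++⁺ (sparse-large-part S₁-sparse (∖-⊆ S₁ H) (remove-half S₁ H H⊆S₁ half) ∷ sets-sparse) Ts-sparse)
            , λ u → begin
                mult (Ss ++ (S₁ ∖ H ∷ sets) ++ Ts) u
                  ≡⟨ trans (mult-++ Ss _ u) (cong (mult Ss u +_) (mult-++ (S₁ ∖ H ∷ sets) Ts u)) ⟩
                mult Ss u + (ind ((S₁ ∖ H) u) + mult sets u + mult Ts u)
                  ≡⟨ cong₂ (λ x y → x + (ind ((S₁ ∖ H) u) + mult sets u + y)) (Ss-covers u) (Ts-covers u) ⟩
                mult Ds u + ind (parkable u) + (ind ((S₁ ∖ H) u) + mult sets u + (ind (H u) + mult (toList Hs) u + ind (leftover u)))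
                  ≡⟨ eq (mult Ds u) (ind (parkable u)) (ind ((S₁ ∖ H) u)) (mult sets u) (ind (H u)) (mult (toList Hs) u) (ind (leftover u)) ⟩
                mult Ds u + mult (toList Hs) u
                  + (ind ((S₁ ∖ H) u) + ind (H u) + (mult sets u + ind (leftover u)) + ind (parkable u))
                  ≡⟨ cong₂ (λ x y → x + (y + (mult sets u + ind (leftover u)) + ind (parkable u))) (mult-∖ Hs⊑Vs u) (ind-⊆ (H⊆S₁ u)) ⟩
                mult (toList Vs) u + (ind (S₁ u) + (mult sets u + ind (leftover u)) + ind (parkable u))
                  ≡⟨ cong (λ x → mult (toList Vs) u + (x + ind (parkable u))) (ind-R′ u) ⟨
                mult (toList Vs) u + (ind (R′ u) + ind (parkable u))
                  ≡⟨ cong (mult (toList Vs) u +_) (ind-R u) ⟨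
                mult (toList Vs) u + ind (R u)
                  ∎
            where
            open ≡-Reasoning
            Ds = toList (zipWith _∖_ Vs Hs)
            eq : ∀ d p s t h x y → d + p + (s + t + (h + x + y)) ≡ d + x + (s + h + (t + y) + p)
            eq = solve-∀

          descend-into : (Σ (Vec (VSet n) (suc k)) λ Hs → Pointwise (Shrunk G M q) (S₁ ∷ Vs) Hs × Rich G M (g * c) Hs) →
            Solution (step + κ) Vs R
          descend-into (H ∷ Hs , (shrunk ∷ shrunks) , rich′) =
            assemble H Hs (proj₁ shrunk) (proj₁ (proj₂ (proj₂ shrunk))) (shrunk-⊑ G M b r 1≤M large-sparse q shrunks)
              (parked (split-hosts q hosts shrunks))
              (next (H ∷ Hs) leftover (new-hosts {c = c} c≤g^r leftover-small counts (shrunk ∷ shrunks))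
                (still-disjoint (shrunk-⊑ G M b r 1≤M large-sparse q (shrunk ∷ shrunks))) rich′)

        descend : Solution (step + κ) Vs R
        descend = descend-into refined

      level-step : Solution (step + κ) Vs R
      level-step with member? leftover
      ... | inj₁ (x , Lx) = descend x Lx
      ... | inj₂ empty =
        let (Ss , len , rest) = exhausted empty
        in Ss , ≤-trans len (m≤m+n step κ) , rest

  -- Induction on the number `j` of missing coordinates. A level multiplies the richness constant by
  -- `g`, so `c * g ^ j ≤ g ^ r` is preserved and keeps `c` within the bound built into `deep`.
  solve-levels : ∀ j {k} → k + j ≡ r → ∀ c → c * g ^ j ≤ g ^ r → (Vs : Vec (VSet n) k) (R : VSet n) →
    Allᵥ (Host (count R)) Vs → (∀ u → mult (toList Vs) u + ind (R u) ≤ 1) → Rich G M c Vs →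
    Solution (suc j * step) Vs R
  solve-levels zero {k} k+0≡r c _ Vs R hosts disjoint rich =
    let k≡r = trans (Eq.sym (+-identityʳ k)) k+0≡r
        (Ss , len , rest) = final-level c (≤-reflexive k≡r) Vs R hosts disjoint rich k≡r
    in Ss , ≤-trans len (≤-trans (≤-reflexive k≡r) (≤-trans (m≤m+n r s) (≤-trans (n≤1+n _) (m≤m+n step 0)))) , rest
  solve-levels (suc j) {k} k+j≡r c c≤ Vs R hosts disjoint rich =
    level-step c (subst (k ≤_) k+j≡r (m≤m+n k (suc j))) Vs R hosts disjoint rich
      (≤-trans (m≤m*n c (g ^ suc j) {{>-nonZero (1≤g^ (suc j))}}) c≤)
      (subst (k <_) k+j≡r (m<m+n k (s≤s z≤n)))
      (λ Hs L hosts′ disjoint′ rich′ → solve-levels j (trans (Eq.sym (+-suc k j)) k+j≡r) (g * c)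
        (≤-trans (≤-reflexive (eq g c (g ^ j))) c≤) Hs L hosts′ disjoint′ rich′)
    where
    eq : ∀ g c x → g * c * x ≡ c * (g * x)
    eq = solve-∀

  sparse-partition : Σ (List (VSet n)) λ Ss →
    length Ss ≤ suc r * step × All (SparseSet G m) Ss × (∀ u → mult Ss u ≡ 1)
  -- Without hosts every vertex is a misfit, and the empty box is rich with constant 1 because its
  -- volume and clique count are both 1.
  sparse-partition = solve-levels r refl 1 (≤-reflexive (+-identityʳ (g ^ r))) [] (const true) []ᵥ
    (λ u → ≤-refl) (λ x _ → ≤-refl)

-- Polynomial bounds

PolyBounded : (ℕ → ℕ) → Set
PolyBounded f = Σ ℕ λ C → ∀ m → 2 ≤ m → f m ≤ m ^ C

poly-const : ∀ c → PolyBounded (const c)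
poly-const c = c , λ m 2≤m → ≤-trans (n≤2^n c) (^-monoˡ-≤ c 2≤m)

poly-id : PolyBounded id
poly-id = 1 , λ m _ → ≤-reflexive (Eq.sym (*-identityʳ m))

poly-* : ∀ {f h} → PolyBounded f → PolyBounded h → PolyBounded (λ m → f m * h m)
poly-* (C , f≤) (D , h≤) = C + D , λ m 2≤m →
  ≤-trans (*-mono-≤ (f≤ m 2≤m) (h≤ m 2≤m)) (≤-reflexive (Eq.sym (^-distribˡ-+-* m C D)))

poly-+ : ∀ {f h} → PolyBounded f → PolyBounded h → PolyBounded (λ m → f m + h m)
poly-+ {f} {h} (C , f≤) (D , h≤) = suc (C + D) , λ m 2≤m →
  let instance m≢0 = >-nonZero {m} (≤-trans (s≤s z≤n) 2≤m) in begin
    f m + h m                          ≤⟨ +-mono-≤ (f≤ m 2≤m) (h≤ m 2≤m) ⟩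
    m ^ C + m ^ D                      ≤⟨ +-mono-≤ (^-monoʳ-≤ m (m≤m+n C D)) (^-monoʳ-≤ m (m≤n+m D C)) ⟩
    m ^ (C + D) + m ^ (C + D)          ≡⟨ cong (m ^ (C + D) +_) (+-identityʳ _) ⟨
    2 * m ^ (C + D)                    ≤⟨ *-monoˡ-≤ (m ^ (C + D)) 2≤m ⟩
    m ^ suc (C + D)                    ∎
  where open ≤-Reasoning

poly-suc : ∀ {f} → PolyBounded f → PolyBounded (λ m → suc (f m))
poly-suc {f} = poly-+ {const 1} {f} (poly-const 1)

poly-^ : ∀ {f} i → PolyBounded f → PolyBounded (λ m → f m ^ i)
poly-^ i (C , f≤) = C * i , λ m 2≤m →
  ≤-trans (^-monoˡ-≤ i (f≤ m 2≤m)) (≤-reflexive (^-*-assoc m C i))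

ListPartitions : ℕ → ℕ → Set
ListPartitions r C = ∀ m → 2 ≤ m → ∀ n (G : Graph n) → KFree (suc r) G →
  Σ (List (VSet n)) λ Ss → length Ss ≤ m ^ C × All (SparseSet G m) Ss × (∀ u → mult Ss u ≡ 1)

module _ (r : ℕ) where

  private
    b depth exponent classes : ℕ → ℕ
    -- The factor lost by `sparse-subset` for cliques of size `suc r` and `M = 4 * m`.
    b m = (4 * m) ^ suc r
    exponent m = suc (slack (4 * m) (b m) r)
    -- Bounding the factors in `DeepEnough` by powers of 2 through x ≤ 2^x, and 3 by 2^2, turns
    -- their product into this sum of exponents, which is polynomial in `m`.
    depth m = 4 * m + (suc (b m) + (2 + suc (b m) + exponent m * (r * exponent m)))
    classes m = suc r * suc (r + suc (b m) * depth m)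

    b-poly : PolyBounded b
    b-poly = poly-^ (suc r) (poly-* (poly-const 4) poly-id)

    a-poly : PolyBounded (λ m → suc (b m))
    a-poly = poly-suc b-poly

    exponent-poly : PolyBounded exponent
    exponent-poly = poly-suc (poly-* (poly-const 2) (poly-* (poly-const r)
      (poly-^ r (poly-* (poly-* (poly-const 3) a-poly) (poly-* (poly-const 4) poly-id)))))

    depth-poly : PolyBounded depth
    depth-poly = poly-+ (poly-* (poly-const 4) poly-id) (poly-+ a-poly
      (poly-+ (poly-+ (poly-const 2) a-poly) (poly-* exponent-poly (poly-* (poly-const r) exponent-poly))))

    classes-poly : PolyBounded classes
    classes-poly = poly-* (poly-const (suc r))
      (poly-suc (poly-+ (poly-const r) (poly-* a-poly depth-poly)))

    depth-enough : ∀ m → DeepEnough m (b m) r (depth m)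
    depth-enough m = begin
      4 * m * (a * (3 * a * (g ^ r) ^ g))
        ≤⟨ *-mono-≤ (n≤2^n (4 * m)) (*-mono-≤ (n≤2^n a)
             (*-mono-≤ (*-mono-≤ {3} {4} (n≤1+n 3) (n≤2^n a)) (^-monoˡ-≤ g (^-monoˡ-≤ r (n≤2^n g))))) ⟩
      2 ^ (4 * m) * (2 ^ a * (2 ^ 2 * 2 ^ a * ((2 ^ g) ^ r) ^ g))
        ≡⟨ cong (λ x → 2 ^ (4 * m) * (2 ^ a * (2 ^ 2 * 2 ^ a * x)))
             (trans (^-*-assoc (2 ^ g) r g) (^-*-assoc 2 g (r * g))) ⟩
      2 ^ (4 * m) * (2 ^ a * (2 ^ 2 * 2 ^ a * 2 ^ (g * (r * g))))
        ≡⟨ cong (λ x → 2 ^ (4 * m) * (2 ^ a * (x * 2 ^ (g * (r * g))))) (^-distribˡ-+-* 2 2 a) ⟨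
      2 ^ (4 * m) * (2 ^ a * (2 ^ (2 + a) * 2 ^ (g * (r * g))))
        ≡⟨ cong (λ x → 2 ^ (4 * m) * (2 ^ a * x)) (^-distribˡ-+-* 2 (2 + a) (g * (r * g))) ⟨
      2 ^ (4 * m) * (2 ^ a * 2 ^ (2 + a + g * (r * g)))
        ≡⟨ cong (2 ^ (4 * m) *_) (^-distribˡ-+-* 2 a _) ⟨
      2 ^ (4 * m) * 2 ^ (a + (2 + a + g * (r * g)))
        ≡⟨ ^-distribˡ-+-* 2 (4 * m) _ ⟨
      2 ^ depth m
        ∎
      where
      open ≤-Reasoning
      a = suc (b m)
      g = exponent m

  polynomial-partition : Σ ℕ (ListPartitions r)
  polynomial-partition = proj₁ classes-poly , λ m 2≤m n G free →
    let 1≤m = ≤-trans (s≤s z≤n) 2≤m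
        ¬clique = KFree⇒¬Clique G (suc r) free
        large-sparse = λ X →
          let (S , S⊆X , sparse , large) = sparse-subset G (4 * m) (*-mono-≤ {1} {4} (s≤s z≤n) 1≤m) (suc r) X
                (λ clique → ¬clique (clique-mono G (suc r) (λ _ _ → refl) clique))
          in S , S⊆X , sparse , ≤-trans large (m≤n+m _ (count S))
        (Ss , len , sparse , once) = sparse-partition G m (b m) r (depth m) 1≤m large-sparse ¬clique (depth-enough m)
    in Ss , ≤-trans len (proj₂ classes-poly m 2≤m) , sparse , once

-- From ε = 1/m to ε = p/q

reciprocal : ∀ p q → 0 < p → 2 * p ≤ q → Σ ℕ λ m → 2 ≤ m × q ≤ m * p × m * (p * p) ≤ q * q
-- `m` is the least integer above q / p. From `m * p ≤ p + q` and `2 * p ≤ q` follows m p² ≤ (3/4)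
-- q², so `m` is at most the square of q / p.
reciprocal p@(suc _) q _ 2p≤q = m , 2≤m , <⇒≤ q<mp , *-cancelˡ-≤ 4 (begin
    4 * (m * (p * p))                          ≡⟨ eq₁ m p ⟩
    4 * (p * (m * p))                          ≤⟨ *-monoʳ-≤ 4 (*-monoʳ-≤ p mp≤p+q) ⟩
    4 * (p * (p + q))                          ≡⟨ eq₂ p q ⟩
    2 * p * (2 * p) + 2 * (2 * p * q)          ≤⟨ +-mono-≤ (*-mono-≤ 2p≤q 2p≤q) (*-monoʳ-≤ 2 (*-monoˡ-≤ q 2p≤q)) ⟩
    q * q + 2 * (q * q)                        ≤⟨ m≤n+m _ (q * q) ⟩
    4 * (q * q)                                ∎)
  where
  open ≤-Reasoning
  m = suc (q / p)
  q<mp : q < m * p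
  q<mp = begin-strict
    q                          ≡⟨ m≡m%n+[m/n]*n q p ⟩
    q % p + q / p * p          <⟨ +-monoˡ-< (q / p * p) (m%n<n q p) ⟩
    m * p                      ∎
  mp≤p+q : m * p ≤ p + q
  mp≤p+q = +-monoʳ-≤ p (≤-trans (m≤n+m (q / p * p) (q % p)) (≤-reflexive (Eq.sym (m≡m%n+[m/n]*n q p))))
  2≤m : 2 ≤ m
  2≤m = *-cancelʳ-< p 1 m (≤-<-trans (≤-trans (*-monoˡ-≤ p {1} {2} (s≤s z≤n)) 2p≤q) q<mp)
  eq₁ : ∀ m p → 4 * (m * (p * p)) ≡ 4 * (p * (m * p))
  eq₁ = solve-∀
  eq₂ : ∀ p q → 4 * (p * (p + q)) ≡ 2 * p * (2 * p) + 2 * (2 * p * q)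
  eq₂ = solve-∀

-- A 1/m-sparse set is p/q-sparse because `q ≤ m * p`, and m ≤ (q/p)² doubles the exponent. Using
-- `suc C` in place of `C` makes the exponent positive.
fractional-sparsity : ∀ r C → ListPartitions r C → (p q : ℕ) → 0 < p → 2 * p ≤ q →
  (n : ℕ) (G : Graph n) → KFree (suc r) G →
  Σ ℕ λ k → k * p ^ (2 * suc C) ≤ q ^ (2 * suc C) ×
  Σ (Fin n → Fin k) λ f → (c : Fin k) → Sparse p q G (classOf f c)
fractional-sparsity r C partitions p q 0<p 2p≤q n G free with reciprocal p q 0<p 2p≤q
... | m , 2≤m , q≤mp , mpp≤qq with partitions m 2≤m n G free
... | Ss , len , sparse , once = length Ss , few , index , sparse-class
  where
  open ≤-Reasoning
  square-^ : ∀ x → (x * x) ^ suc C ≡ x ^ (2 * suc C)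
  square-^ x = trans (cong (λ y → (x * y) ^ suc C) (Eq.sym (*-identityʳ x))) (^-*-assoc x 2 (suc C))
  index : Fin n → Fin (length Ss)
  index u = proj₁ (class-index Ss u (once u))
  class≡ : ∀ c u → classOf index c u ≡ lookup Ss c u
  class≡ c u = proj₂ (class-index Ss u (once u)) c
  few : length Ss * p ^ (2 * suc C) ≤ q ^ (2 * suc C)
  few = begin
    length Ss * p ^ (2 * suc C)            ≤⟨ *-monoˡ-≤ _ (≤-trans len (m≤n*m (m ^ C) m {{>-nonZero (≤-trans (s≤s z≤n) 2≤m)}})) ⟩
    m ^ suc C * p ^ (2 * suc C)            ≡⟨ cong (m ^ suc C *_) (square-^ p) ⟨
    m ^ suc C * (p * p) ^ suc C            ≡⟨ ^-distribʳ-* (suc C) m (p * p) ⟨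
    (m * (p * p)) ^ suc C                  ≤⟨ ^-monoˡ-≤ (suc C) mpp≤qq ⟩
    (q * q) ^ suc C                        ≡⟨ square-^ q ⟩
    q ^ (2 * suc C)                        ∎
  sparse-class : (c : Fin (length Ss)) → Sparse p q G (classOf index c)
  sparse-class c v cv = begin
    degIn G A v * q                        ≤⟨ *-mono-≤ (count-mono (A ∩ adj G v) (S ∩ adj G v) A∩N⊆S∩N) q≤mp ⟩
    degIn G S v * (m * p)                  ≡⟨ *-assoc (degIn G S v) m p ⟨
    degIn G S v * m * p                    ≤⟨ *-monoˡ-≤ p (All.lookup sparse (∈-lookup c) v (A⊆S v cv)) ⟩
    count S * p                            ≤⟨ *-monoˡ-≤ p (count-mono S A λ u eq → trans (class≡ c u) eq) ⟩
    count A * p                            ≡⟨ *-comm (count A) p ⟩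
    p * count A                            ∎
    where
    A = classOf index c
    S = lookup Ss c
    A⊆S : A ⊆ S
    A⊆S u eq = trans (Eq.sym (class≡ c u)) eq
    A∩N⊆S∩N : A ∩ adj G v ⊆ S ∩ adj G v
    A∩N⊆S∩N u eq with ∧-true {A u} eq
    ... | Au , Nu = ∧-intro (A⊆S u Au) Nu

theorem8 : (r : ℕ) → 2 ≤ r →
    Σ ℕ λ C → 0 < C ×
    ((p q : ℕ) → 0 < p → 2 * p ≤ q →
    (n : ℕ) (G : Graph n) → KFree (suc r) G →
    Σ ℕ λ k → k * p ^ C ≤ q ^ C ×
    Σ (Fin n → Fin k) λ f → (c : Fin k) → Sparse p q G (classOf f c))
theorem8 r _ =
  let (C , partitions) = polynomial-partition r
  in 2 * suc C , s≤s z≤n , fractional-sparsity r C partitions
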